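{- Let $\mathbf{d}=(d_1,\dots,d_n)$ be a multigraphical sequence and let $s=\sum_{i=1}^n d_i$ (so every realization has $m=s/2$ edges). Then $\mathbf{d}$ is TC-realizable (as a multigraph) if and only if one of the following holds: (1) $s=4(n-1)-4$ (i.e. $m=2n-4$) and $d_n\ge 2$; or (2) $s\ge 4(n-1)-2$ (i.e. $m\ge 2n-3$), and either (a) $n\le 2$, or (b) $n>2$, $d_{n-1}\ge 2$ and $d_n\ge 1$.
   Context: A degree sequence is a non-increasing sequence $d_1\ge\dots\ge d_n$ of non-negative integers; it is multigraphical if some loopless multigraph (parallel edges allowed) on vertices $v_1,\dots,v_n$ has $\deg(v_i)=d_i$ for all $i$ (a realization). A temporal multigraph is a pair $(G,\lambda)$ where $G$ is a loopless multigraph and $\lambda$ assigns to each edge (each copy of a parallel edge separately) exactly one positive integer label; $\lambda$ is proper if any two distinct edges sharing an endpoint (including parallel copies) receive different labels. A temporal path is a path $e_1,\dots,e_k$ in $G$ whose labels $\lambda(e_1),\dots,\lambda(e_k)$ are non-decreasing (hence strictly increasing for proper labelings). $(G,\lambda)$ is temporally connected if for every ordered pair of vertices $(u,v)$ there is a temporal path from $u$ to $v$. A multigraphical sequence $\mathbf{d}$ is TC-realizable if some multigraph realization $G$ of $\mathbf{d}$ admits a proper labeling $\lambda$ (one label per edge) with $(G,\lambda)$ temporally connected. (Equivalently, a non-simple proper labeling of the underlying simple graph where the number of labels of an edge equals its multiplicity.) -}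

module Defs where

open import Data.Nat using (ℕ; zero; suc; _+_; _≤_; _<_)
open import Data.Fin using (Fin; toℕ)
open import Data.Product using (_×_; _,_; proj₁; proj₂; ∃; ∃-syntax; Σ-syntax)
open import Data.Sum using (_⊎_)
open import Data.List using (List; []; _∷_; length; lookup)
open import Data.List.Relation.Unary.Unique.Propositional using (Unique)
open import Relation.Binary.PropositionalEquality using (_≡_; _≢_)
open import Relation.Nullary using (¬_; yes; no)
import Data.Fin as F

-- A sequence of length n, indexed by Fin n (position i ↦ d_{i+1}).
Seq : ℕ → Set
Seq n = Fin n → ℕ

total : ∀ {n} → Seq n → ℕ
total {zero}  d = 0
total {suc n} d = d F.zero + total (λ i → d (F.suc i))

NonIncreasing : ∀ {n} → Seq n → Set
NonIncreasing {n} d = (i j : Fin n) → toℕ i ≤ toℕ j → d j ≤ d i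

-- "d_j ≥ k" for the 1-based position j (vacuous if position j does not exist).
AtLeastAt : ∀ {n} → Seq n → ℕ → ℕ → Set
AtLeastAt {n} d j k = (i : Fin n) → suc (toℕ i) ≡ j → k ≤ d i

-- A multigraph on vertex set Fin n: a list of edges (each parallel copy listed
-- separately); looplessness is a separate predicate.
Multigraph : ℕ → Set
Multigraph n = List (Fin n × Fin n)

Loopless : ∀ {n} → Multigraph n → Set
Loopless G = (e : Fin (length G)) → proj₁ (lookup G e) ≢ proj₂ (lookup G e)

Edge : ∀ {n} → Multigraph n → Set
Edge G = Fin (length G)

ind : ∀ {n} → Fin n → Fin n → ℕ
ind a v with a F.≟ v
... | yes _ = 1
... | no  _ = 0

deg : ∀ {n} → Multigraph n → Fin n → ℕ
deg []            v = 0
deg ((a , b) ∷ G) v = ind a v + ind b v + deg G v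

Realizes : ∀ {n} → Multigraph n → Seq n → Set
Realizes G d = Loopless G × ((v : _) → deg G v ≡ d v)

Multigraphical : ∀ {n} → Seq n → Set
Multigraphical {n} d = ∃[ G ] Realizes {n} G d

Labeling : ∀ {n} → Multigraph n → Set
Labeling G = Edge G → ℕ

Positive : ∀ {n} {G : Multigraph n} → Labeling G → Set
Positive λ′ = ∀ e → 1 ≤ λ′ e

Joins : ∀ {n} (G : Multigraph n) → Edge G → Fin n → Fin n → Set
Joins G e u w = (proj₁ (lookup G e) ≡ u × proj₂ (lookup G e) ≡ w)
              ⊎ (proj₁ (lookup G e) ≡ w × proj₂ (lookup G e) ≡ u)

ShareEndpoint : ∀ {n} (G : Multigraph n) → Edge G → Edge G → Set
ShareEndpoint G e f = ∃[ x ] ((∃[ y ] Joins G e x y) × (∃[ z ] Joins G f x z))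

Proper : ∀ {n} (G : Multigraph n) → Labeling G → Set
Proper G λ′ = (e f : Edge G) → e ≢ f → ShareEndpoint G e f → λ′ e ≢ λ′ f

-- A walk from u to v using edges e₁,…,e_k with non-decreasing labels,
-- all labels ≥ t (t is the label of the previously used edge; start with 0).
data TWalk {n} (G : Multigraph n) (λ′ : Labeling G) (t : ℕ) : Fin n → Fin n → Set where
  stop : ∀ {v} → TWalk G λ′ t v v
  step : ∀ {u w v} (e : Edge G) → Joins G e u w → t ≤ λ′ e →
         TWalk G λ′ (λ′ e) w v → TWalk G λ′ t u v

verts : ∀ {n} {G : Multigraph n} {λ′ : Labeling G} {t u v} → TWalk G λ′ t u v → List (Fin n)
verts {v = v} stop = v ∷ []
verts {u = u} (step e _ _ w) = u ∷ verts w

TemporalPath : ∀ {n} (G : Multigraph n) → Labeling G → Fin n → Fin n → Set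
TemporalPath G λ′ u v = Σ[ w ∈ TWalk G λ′ 0 u v ] Unique (verts w)

TemporallyConnected : ∀ {n} (G : Multigraph n) → Labeling G → Set
TemporallyConnected {n} G λ′ = (u v : Fin n) → TemporalPath G λ′ u v

TCRealizable : ∀ {n} → Seq n → Set
TCRealizable {n} d = ∃[ G ] (Realizes {n} G d ×
  ∃[ λ′ ] (Positive {n} {G} λ′ × Proper G λ′ × TemporallyConnected G λ′))

{-# OPTIONS --safe #-}
module Submission where

-- Sort the edges by label: a temporally connected proper labeling becomes a list of
-- telephone calls after which everybody knows everything, and conversely the positions
-- in such a list are a proper labeling.
--
-- Necessity. The gossip theorem m ≥ 2n - 4 is proved along the lines of Baker and Shostak.
-- If some A hears its own information, A can be deleted: its calls are handed over to a
-- token that rides along the closed walk, and the first and the last call of that walk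
-- become loops.  Otherwise a call can both spread the information of A and carry
-- information to A only if A takes part in it, which gives m + deg A ≥ 2n - 2; this also
-- settles a vertex A of degree one.  If m ≤ 2n - 5, all degrees are thus at least 3, some
-- A has degree 3, and no call is useless for A.  The last calls form a perfect matching
-- and each informs exactly one of its participants about A, so exactly half of the
-- vertices are informed before their last call; dually for the first calls.  But every
-- vertex has a call in between, so it belongs to one of these halves, and A to both.
--
-- Sufficiency. Choose roots that exchange everything through few calls C (no call for one
-- root, one call for two roots, a 4-cycle for four roots), and first gather along a forest
-- towards the roots, then call C, then broadcast along a second forest.  The numbers of
-- children in the two forests can be prescribed freely, up to the total and to each forest
-- having a root with a child.

open import Defs
open import Data.Bool using (Bool; true; false; _∨_; _∧_; not; _xor_)
import Data.Bool as Bool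
open import Data.Bool.Properties using (∨-zeroʳ)
open import Data.Empty using (⊥; ⊥-elim)
open import Data.Fin as F using (Fin; toℕ; fromℕ<; punchIn; punchOut)
open import Data.Fin.Properties using (any?; punchIn-punchOut; punchOut-punchIn; punchInᵢ≢i; punchOut-cong; toℕ-injective; toℕ-fromℕ<; toℕ<n)
open import Data.List using (List; []; _∷_; _++_; _ʳ++_; length; lookup; map; reverse)
open import Data.List.Membership.Propositional using (_∈_)
open import Data.List.Properties using (++-ʳ++; ʳ++-ʳ++; ++-identityʳ; reverse-involutive; length-reverse; length-ʳ++)
open import Data.List.Relation.Binary.Permutation.Propositional using (_↭_; prep; swap; ↭-refl; ↭-sym; ↭-trans)
open import Data.List.Relation.Binary.Permutation.Propositional.Properties using (∈-resp-↭; All-resp-↭; map⁺)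
open import Data.List.Relation.Unary.All as All using (All; []; _∷_)
open import Data.List.Relation.Unary.All.Properties using (¬Any⇒All¬)
open import Data.List.Relation.Unary.AllPairs using (AllPairs; []; _∷_)
open import Data.List.Relation.Unary.Any as Any using (here; there)
open import Data.List.Relation.Unary.Unique.Propositional using (Unique)
open import Data.Nat using (ℕ; zero; suc; _+_; _*_; _∸_; _⊓_; _≤_; _<_; z≤n; s≤s; s≤s⁻¹; _≤?_)
open import Data.Nat.Properties
open import Data.Nat.Tactic.RingSolver using (solve-∀)
open import Data.Product using (_×_; _,_; proj₁; proj₂; ∃; ∃-syntax; Σ-syntax)
open import Data.Sum using (_⊎_; inj₁; inj₂)
open import Function using (_∘_)
open import Function.Bundles using (_⇔_; mk⇔)
open import Relation.Binary.PropositionalEquality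
open import Relation.Nullary using (¬_; yes; no; does; contradiction)
open import Relation.Nullary.Decidable using (_×-dec_; ¬?)

-- Certificate form of linear arithmetic: k is the slack of the combination.
≤-by : ∀ {x y a b} k → x ≤ y → a + y + k ≡ b + x → a ≤ b
≤-by {x} {y} {a} {b} k x≤y eq = +-cancelʳ-≤ x a b (begin
  a + x       ≤⟨ +-monoʳ-≤ a x≤y ⟩
  a + y       ≤⟨ m≤m+n (a + y) k ⟩
  a + y + k   ≡⟨ eq ⟩
  b + x       ∎)
  where open ≤-Reasoning

absurd-by : ∀ {x y} k → x ≤ y → y + suc k ≡ x → ⊥
absurd-by {x} {y} k x≤y eq = m+1+n≰m y (≤-trans (≤-reflexive eq) x≤y)

-- Truth values as numbers and Boolean equality of vertices.

⟦_⟧ : Bool → ℕ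
⟦ true ⟧ = 1
⟦ false ⟧ = 0

⟦⟧≤1 : ∀ b → ⟦ b ⟧ ≤ 1
⟦⟧≤1 true = ≤-refl
⟦⟧≤1 false = z≤n

∨-trueʳ : ∀ {a b} → b ≡ true → a ∨ b ≡ true
∨-trueʳ {a} refl = ∨-zeroʳ a

∨-trueˡ : ∀ {a b} → a ≡ true → a ∨ b ≡ true
∨-trueˡ refl = refl

∨-elim : ∀ a {b} → a ∨ b ≡ true → a ≡ true ⊎ b ≡ true
∨-elim true _ = inj₁ refl
∨-elim false p = inj₂ p

∧-elim : ∀ a {b} → a ∧ b ≡ true → a ≡ true × b ≡ true
∧-elim true p = refl , p

module _ {n : ℕ} where

  _==_ : Fin n → Fin n → Bool
  a == x = does (a F.≟ x)

  ==-refl : ∀ a → (a == a) ≡ true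
  ==-refl a with a F.≟ a
  ... | yes _ = refl
  ... | no a≢a = contradiction refl a≢a

  ==⇒≡ : ∀ a x → (a == x) ≡ true → a ≡ x
  ==⇒≡ a x p with a F.≟ x
  ... | yes a≡x = a≡x
  ... | no _ with () ← p

  ≢⇒==false : ∀ {a x} → a ≢ x → (a == x) ≡ false
  ≢⇒==false {a} {x} a≢x with a F.≟ x
  ... | yes a≡x = contradiction a≡x a≢x
  ... | no _ = refl

  ind≡ : ∀ a x → ind {n} a x ≡ ⟦ a == x ⟧
  ind≡ a x with a F.≟ x
  ... | yes _ = refl
  ... | no _ = refl

  ind-refl : ∀ a → ind {n} a a ≡ 1
  ind-refl a = trans (ind≡ a a) (cong ⟦_⟧ (==-refl a))

  ind-≢ : ∀ {a x} → a ≢ x → ind {n} a x ≡ 0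
  ind-≢ {a} {x} a≢x = trans (ind≡ a x) (cong ⟦_⟧ (≢⇒==false a≢x))

ind-suc : ∀ {n} (a x : Fin n) → ind (F.suc a) (F.suc x) ≡ ind a x
ind-suc a x with a F.≟ x
... | yes _ = refl
... | no _ = refl

-- Finite sums

total-cong : ∀ {n} {f g : Seq n} → (∀ x → f x ≡ g x) → total f ≡ total g
total-cong {zero} e = refl
total-cong {suc n} e = cong₂ _+_ (e F.zero) (total-cong (e ∘ F.suc))

total-mono : ∀ {n} {f g : Seq n} → (∀ x → f x ≤ g x) → total f ≤ total g
total-mono {zero} e = z≤n
total-mono {suc n} e = +-mono-≤ (e F.zero) (total-mono (e ∘ F.suc))

total-+ : ∀ {n} (f g : Seq n) → total (λ x → f x + g x) ≡ total f + total g
total-+ {zero} f g = refl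
total-+ {suc n} f g = trans (cong (f F.zero + g F.zero +_) (total-+ (f ∘ F.suc) (g ∘ F.suc)))
  (lemma (f F.zero) (g F.zero) (total (f ∘ F.suc)) (total (g ∘ F.suc)))
  where
  lemma : ∀ a b c d → a + b + (c + d) ≡ a + c + (b + d)
  lemma = solve-∀

total-const : ∀ n k → total {n} (λ _ → k) ≡ n * k
total-const zero k = refl
total-const (suc n) k = cong (k +_) (total-const n k)

total-*ˡ : ∀ {n} k (f : Seq n) → total (λ x → k * f x) ≡ k * total f
total-*ˡ {zero} k f = sym (*-zeroʳ k)
total-*ˡ {suc n} k f = trans (cong (k * f F.zero +_) (total-*ˡ k (f ∘ F.suc)))
  (sym (*-distribˡ-+ k (f F.zero) _))

total-ind-* : ∀ {n} (a : Fin n) (f : Seq n) → total (λ x → ind a x * f x) ≡ f a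
total-ind-* {suc n} F.zero f = begin
  f F.zero + 0 + total {n} (λ x → 0)  ≡⟨ cong (f F.zero + 0 +_) (trans (total-const n 0) (*-zeroʳ n)) ⟩
  f F.zero + 0 + 0                    ≡⟨ trans (+-identityʳ _) (+-identityʳ _) ⟩
  f F.zero                            ∎
  where open ≡-Reasoning
total-ind-* {suc n} (F.suc a) f =
  trans (total-cong λ x → cong (_* f (F.suc x)) (ind-suc a x)) (total-ind-* a (f ∘ F.suc))

total-ind : ∀ {n} (a : Fin n) → total (ind a) ≡ 1
total-ind a = trans (total-cong λ x → sym (*-identityʳ (ind a x))) (total-ind-* a (λ _ → 1))

term≤total : ∀ {n} (f : Seq n) x → f x ≤ total f
term≤total f F.zero = m≤m+n _ _
term≤total f (F.suc x) = ≤-trans (term≤total (f ∘ F.suc) x) (m≤n+m _ (f F.zero))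

total-positive : ∀ {n} (f : Seq n) → 1 ≤ total f → ∃[ x ] 1 ≤ f x
total-positive {suc n} f 1≤ with f F.zero in eq
... | suc _ = F.zero , subst (1 ≤_) (sym eq) (s≤s z≤n)
... | zero with x , p ← total-positive (f ∘ F.suc) 1≤ = F.suc x , p

-- Information flow along chronological lists of calls

-- cs ⊢ x ⇝ y: a walk from x to y whose calls appear in this order in cs.
data _⊢_⇝_ {n} : Multigraph n → Fin n → Fin n → Set where
  here : ∀ {x} → [] ⊢ x ⇝ x
  skip : ∀ {c cs x y} → cs ⊢ x ⇝ y → (c ∷ cs) ⊢ x ⇝ y
  fwd  : ∀ {a b cs y} → cs ⊢ b ⇝ y → ((a , b) ∷ cs) ⊢ a ⇝ y
  bwd  : ∀ {a b cs y} → cs ⊢ a ⇝ y → ((a , b) ∷ cs) ⊢ b ⇝ y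

NoLoop : ∀ {n} → Fin n × Fin n → Set
NoLoop (a , b) = a ≢ b

Complete : ∀ {n} → Multigraph n → Set
Complete cs = ∀ x y → cs ⊢ x ⇝ y

module _ {n : ℕ} where

  private
    Calls : Set
    Calls = Multigraph n

  ⇝-refl : ∀ (cs : Calls) {x} → cs ⊢ x ⇝ x
  ⇝-refl [] = here
  ⇝-refl (c ∷ cs) = skip (⇝-refl cs)

  ⇝-++ : ∀ {xs ys : Calls} {x y z} → xs ⊢ x ⇝ y → ys ⊢ y ⇝ z → (xs ++ ys) ⊢ x ⇝ z
  ⇝-++ here q = q
  ⇝-++ (skip p) q = skip (⇝-++ p q)
  ⇝-++ (fwd p) q = fwd (⇝-++ p q)
  ⇝-++ (bwd p) q = bwd (⇝-++ p q)

  -- Reversing time reverses walks. In `xs ʳ++ ys` the list `xs` acts as the past, most recent call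
  -- first, and `ys` as the future; walks out of a common vertex into past and future join to one
  -- walk.
  ⇝-ʳ++ : ∀ {xs ys : Calls} {x y z} → xs ⊢ x ⇝ y → ys ⊢ x ⇝ z → (xs ʳ++ ys) ⊢ y ⇝ z
  ⇝-ʳ++ here q = q
  ⇝-ʳ++ (skip p) q = ⇝-ʳ++ p (skip q)
  ⇝-ʳ++ (fwd p) q = ⇝-ʳ++ p (bwd q)
  ⇝-ʳ++ (bwd p) q = ⇝-ʳ++ p (fwd q)

  deg-++ : ∀ (xs ys : Calls) v → deg (xs ++ ys) v ≡ deg xs v + deg ys v
  deg-++ [] ys v = refl
  deg-++ ((a , b) ∷ xs) ys v = trans (cong (ind a v + ind b v +_) (deg-++ xs ys v))
    (sym (+-assoc (ind a v + ind b v) (deg xs v) (deg ys v)))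

  deg-ʳ++ : ∀ (xs ys : Calls) v → deg (xs ʳ++ ys) v ≡ deg xs v + deg ys v
  deg-ʳ++ [] ys v = refl
  deg-ʳ++ ((a , b) ∷ xs) ys v = trans (deg-ʳ++ xs ((a , b) ∷ ys) v)
    (lemma (ind a v + ind b v) (deg xs v) (deg ys v))
    where
    lemma : ∀ a b c → b + (a + c) ≡ a + b + c
    lemma = solve-∀

  total-deg : ∀ (cs : Calls) → total (deg cs) ≡ 2 * length cs
  total-deg [] = trans (total-const n 0) (*-zeroʳ n)
  total-deg ((a , b) ∷ cs) = begin
    total (λ v → ind a v + ind b v + deg cs v)         ≡⟨ total-+ (λ v → ind a v + ind b v) (deg cs) ⟩
    total (λ v → ind a v + ind b v) + total (deg cs)
      ≡⟨ cong₂ _+_ (trans (total-+ (ind a) (ind b)) (cong₂ _+_ (total-ind a) (total-ind b))) (total-deg cs) ⟩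
    2 + 2 * length cs                                  ≡⟨ *-suc 2 (length cs) ⟨
    2 * suc (length cs)                                ∎
    where open ≡-Reasoning

  ind-call≤1 : ∀ {a b : Fin n} → a ≢ b → ∀ v → ind a v + ind b v ≤ 1
  ind-call≤1 {a} {b} a≢b v with a F.≟ v | b F.≟ v
  ... | yes refl | yes refl = contradiction refl a≢b
  ... | yes _ | no _ = ≤-refl
  ... | no _ | yes _ = ≤-refl
  ... | no _ | no _ = z≤n

  deg≤length : ∀ {cs : Calls} → All NoLoop cs → ∀ v → deg cs v ≤ length cs
  deg≤length [] v = z≤n
  deg≤length (a≢b ∷ nl) v = +-mono-≤ (ind-call≤1 a≢b v) (deg≤length nl v)

  NoLoop-++ : ∀ {xs ys : Calls} → All NoLoop xs → All NoLoop ys → All NoLoop (xs ++ ys)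
  NoLoop-++ [] q = q
  NoLoop-++ (p ∷ ps) q = p ∷ NoLoop-++ ps q

  NoLoop-ʳ++ : ∀ {xs ys : Calls} → All NoLoop xs → All NoLoop ys → All NoLoop (xs ʳ++ ys)
  NoLoop-ʳ++ [] q = q
  NoLoop-ʳ++ (p ∷ ps) q = NoLoop-ʳ++ ps (p ∷ q)

  NoLoop-ʳ++⁻ : ∀ (xs : Calls) {ys} → All NoLoop (xs ʳ++ ys) → All NoLoop ys
  NoLoop-ʳ++⁻ [] q = q
  NoLoop-ʳ++⁻ (x ∷ xs) q with _ ∷ q′ ← NoLoop-ʳ++⁻ xs q = q′

  hit : Fin n × Fin n → Fin n → Bool
  hit (a , b) x = (a == x) ∨ (b == x)

  hit₁ : ∀ a b → hit (a , b) a ≡ true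
  hit₁ a b rewrite ==-refl a = refl

  hit₂ : ∀ a b → hit (a , b) b ≡ true
  hit₂ a b = ∨-trueʳ (==-refl b)

  hit-elim : ∀ a b x → hit (a , b) x ≡ true → a ≡ x ⊎ b ≡ x
  hit-elim a b x h with ∨-elim (a == x) h
  ... | inj₁ p = inj₁ (==⇒≡ a x p)
  ... | inj₂ p = inj₂ (==⇒≡ b x p)

  ind-call≡hit : ∀ {a b : Fin n} → a ≢ b → ∀ v → ind a v + ind b v ≡ ⟦ hit (a , b) v ⟧
  ind-call≡hit {a} {b} a≢b v with a F.≟ v | b F.≟ v
  ... | yes refl | yes refl = contradiction refl a≢b
  ... | yes _ | no _ = refl
  ... | no _ | yes _ = refl
  ... | no _ | no _ = refl

  total-hit : ∀ {a b} → a ≢ b → (g : Fin n → Bool) →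
              total (λ x → ⟦ hit (a , b) x ∧ g x ⟧) ≡ ⟦ g a ⟧ + ⟦ g b ⟧
  total-hit {a} {b} a≢b g = begin
    total (λ x → ⟦ hit (a , b) x ∧ g x ⟧)                ≡⟨ total-cong pointwise ⟩
    total (λ x → ind a x * ⟦ g x ⟧ + ind b x * ⟦ g x ⟧)  ≡⟨ total-+ (λ x → ind a x * ⟦ g x ⟧) (λ x → ind b x * ⟦ g x ⟧) ⟩
    total (λ x → ind a x * ⟦ g x ⟧) + total (λ x → ind b x * ⟦ g x ⟧)
      ≡⟨ cong₂ _+_ (total-ind-* a (⟦_⟧ ∘ g)) (total-ind-* b (⟦_⟧ ∘ g)) ⟩
    ⟦ g a ⟧ + ⟦ g b ⟧                                    ∎
    where
    open ≡-Reasoning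
    pointwise : ∀ x → ⟦ hit (a , b) x ∧ g x ⟧ ≡ ind a x * ⟦ g x ⟧ + ind b x * ⟦ g x ⟧
    pointwise x with a F.≟ x | b F.≟ x
    ... | yes refl | yes refl = contradiction refl a≢b
    ... | yes _ | no _ = sym (trans (+-identityʳ _) (+-identityʳ _))
    ... | no _ | yes _ = sym (+-identityʳ _)
    ... | no _ | no _ = refl

  occ : Calls → Fin n → Bool
  occ [] x = false
  occ (c ∷ cs) x = hit c x ∨ occ cs x

  occ⇒deg : ∀ {cs : Calls} {x} → All NoLoop cs → occ cs x ≡ true → 1 ≤ deg cs x
  occ⇒deg {(a , b) ∷ cs} {x} (a≢b ∷ nl) o rewrite ind-call≡hit a≢b x with hit (a , b) x
  ... | true = s≤s z≤n
  ... | false = occ⇒deg nl o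

  deg⇒occ : ∀ {cs : Calls} {x} → All NoLoop cs → 1 ≤ deg cs x → occ cs x ≡ true
  deg⇒occ {(a , b) ∷ cs} {x} (a≢b ∷ nl) d rewrite ind-call≡hit a≢b x with hit (a , b) x
  ... | true = refl
  ... | false = deg⇒occ nl d

  -- reaches A cs x decides cs ⊢ x ⇝ A; on the reversed prefix of a call list
  -- it says that x has been informed of A.
  reaches : Fin n → Calls → Fin n → Bool
  reaches A [] x = A == x
  reaches A (c ∷ cs) x =
    reaches A cs x ∨ (hit c x ∧ (reaches A cs (proj₁ c) ∨ reaches A cs (proj₂ c)))

  reaches-skip : ∀ {A c cs x} → reaches A cs x ≡ true → reaches A (c ∷ cs) x ≡ true
  reaches-skip p = ∨-trueˡ p

  reaches-call : ∀ {A a b} cs {x y} → hit (a , b) x ≡ true → hit (a , b) y ≡ true →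
                 reaches A cs y ≡ true → reaches A ((a , b) ∷ cs) x ≡ true
  reaches-call {A} {a} {b} cs {x} {y} hx hy p = ∨-trueʳ {reaches A cs x} (trans (cong (_∧ _) hx) (aux (hit-elim a b y hy)))
    where
    aux : a ≡ y ⊎ b ≡ y → reaches A cs a ∨ reaches A cs b ≡ true
    aux (inj₁ refl) = ∨-trueˡ p
    aux (inj₂ refl) = ∨-trueʳ p

  reaches-call⁻ : ∀ {A a b} cs {x} → reaches A ((a , b) ∷ cs) x ≡ true →
                  reaches A cs x ≡ true ⊎ ∃[ y ] (hit (a , b) x ≡ true × hit (a , b) y ≡ true × reaches A cs y ≡ true)
  reaches-call⁻ {A} {a} {b} cs {x} p with ∨-elim (reaches A cs x) p
  ... | inj₁ q = inj₁ q
  ... | inj₂ q with h , r ← ∧-elim (hit (a , b) x) q with ∨-elim (reaches A cs a) r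
  ... | inj₁ s = inj₂ (a , h , hit₁ a b , s)
  ... | inj₂ s = inj₂ (b , h , hit₂ a b , s)

  ⇝⇒reaches : ∀ {cs : Calls} {x A} → cs ⊢ x ⇝ A → reaches A cs x ≡ true
  ⇝⇒reaches {A = A} here = ==-refl A
  ⇝⇒reaches {c ∷ cs} {x} (skip p) = reaches-skip {c = c} {cs} {x} (⇝⇒reaches p)
  ⇝⇒reaches {(a , b) ∷ cs} (fwd p) = reaches-call cs (hit₁ a b) (hit₂ a b) (⇝⇒reaches p)
  ⇝⇒reaches {(a , b) ∷ cs} (bwd p) = reaches-call cs (hit₂ a b) (hit₁ a b) (⇝⇒reaches p)

  reaches⇒⇝ : ∀ {cs : Calls} {x A} → reaches A cs x ≡ true → cs ⊢ x ⇝ A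
  reaches⇒⇝ {[]} {x} {A} p with refl ← ==⇒≡ A x p = here
  reaches⇒⇝ {(a , b) ∷ cs} {x} {A} p with reaches-call⁻ cs {x} p
  ... | inj₁ q = skip (reaches⇒⇝ q)
  ... | inj₂ (y , hx , hy , q) with hit-elim a b x hx | hit-elim a b y hy
  ... | inj₁ refl | inj₁ refl = skip (reaches⇒⇝ q)
  ... | inj₁ refl | inj₂ refl = fwd (reaches⇒⇝ q)
  ... | inj₂ refl | inj₁ refl = bwd (reaches⇒⇝ q)
  ... | inj₂ refl | inj₂ refl = skip (reaches⇒⇝ q)

-- Deleting a vertex that hears its own information

module _ {n : ℕ} (A : Fin (suc n)) where

  private
    ↑ : Fin n → Fin (suc n)
    ↑ = punchIn A

  -- A token riding along the calls while avoiding A; the number counts the calls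
  -- between A and the current position of the token.
  data Token : Multigraph (suc n) → Fin n → Fin n → ℕ → Set where
    nil   : ∀ {p} → Token [] p p 0
    stay  : ∀ {c cs p q k} → Token cs p q k → Token (c ∷ cs) p q k
    move  : ∀ {a b cs q k} → a ≢ b → Token cs b q k → Token ((↑ a , ↑ b) ∷ cs) a q k
    move′ : ∀ {a b cs q k} → a ≢ b → Token cs a q k → Token ((↑ a , ↑ b) ∷ cs) b q k
    meet  : ∀ {cs p q k} → Token cs p q k → Token ((A , ↑ p) ∷ cs) p q (suc k)
    meet′ : ∀ {cs p q k} → Token cs p q k → Token ((↑ p , A) ∷ cs) p q (suc k)

  -- A view that exhibits every vertex other than `A` as a value of `punchIn A`, the form required
  -- by the constructors of `Token`.
  data Side : Fin (suc n) → Set where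
    self  : Side A
    other : ∀ x → Side (↑ x)

  side : ∀ y → Side y
  side y with A F.≟ y
  ... | yes refl = self
  ... | no A≢y = subst Side (punchIn-punchOut A≢y) (other (punchOut A≢y))

  -- `A` is identified with the vertex that the token currently occupies.
  project : Fin n → Fin (suc n) → Fin n
  project p y with A F.≟ y
  ... | yes _ = p
  ... | no A≢y = punchOut A≢y

  project-self : ∀ p → project p A ≡ p
  project-self p with A F.≟ A
  ... | yes _ = refl
  ... | no A≢A = contradiction refl A≢A

  project-other : ∀ p x → project p (↑ x) ≡ x
  project-other p x with A F.≟ ↑ x
  ... | yes A≡ = contradiction (sym A≡) (punchInᵢ≢i A x)
  ... | no A≢ = trans (punchOut-cong A refl) (punchOut-punchIn A)

  token-stay : ∀ cs p → Token cs p p 0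
  token-stay [] p = nil
  token-stay (c ∷ cs) p = stay (token-stay cs p)

  -- The token follows the walk up to its first step into `A`. That call becomes a meeting and the
  -- token rests from then on, which makes the count exactly 1.
  token-meets : ∀ {cs x} → All NoLoop cs → cs ⊢ x ⇝ A → ∀ y → x ≡ ↑ y → ∃[ q ] Token cs y q 1
  token-meets nl here y A≡ = contradiction (sym A≡) (punchInᵢ≢i A y)
  token-meets (_ ∷ nl) (skip p) y e with q , t ← token-meets nl p y e = q , stay t
  token-meets (a≢b ∷ nl) (fwd {b = b} {cs} p) y refl with side b
  ... | self = y , meet′ (token-stay cs y)
  ... | other z with q , t ← token-meets nl p z refl = q , move (λ y≡z → a≢b (cong ↑ y≡z)) t
  token-meets (a≢b ∷ nl) (bwd {a = a} {cs = cs} p) y refl with side a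
  ... | self = y , meet (token-stay cs y)
  ... | other z with q , t ← token-meets nl p z refl = q , move′ (λ z≡y → a≢b (cong ↑ z≡y)) t

  token-ʳ++ : ∀ {xs ys p q r j k} → Token xs q p j → Token ys q r k → Token (xs ʳ++ ys) p r (j + k)
  token-ʳ++ nil u = u
  token-ʳ++ (stay t) u = token-ʳ++ t (stay u)
  token-ʳ++ (move a≢b t) u = token-ʳ++ t (move′ a≢b u)
  token-ʳ++ (move′ a≢b t) u = token-ʳ++ t (move a≢b u)
  token-ʳ++ {j = suc j} {k} (meet t) u = subst (Token _ _ _) (+-suc j k) (token-ʳ++ t (meet u))
  token-ʳ++ {j = suc j} {k} (meet′ t) u = subst (Token _ _ _) (+-suc j k) (token-ʳ++ t (meet′ u))

  record Quotient (cs : Multigraph (suc n)) (p q : Fin n) (k : ℕ) : Set where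
    constructor quotient
    field
      calls  : Multigraph n
      noLoop : All NoLoop calls
      size   : length calls + k ≤ length cs
      flow   : ∀ {x y} → cs ⊢ x ⇝ y → calls ⊢ project p x ⇝ project q y

  -- While the token is at p, the calls of A are handed over to p.
  token-quotient : ∀ {cs p q k} → Token cs p q k → Quotient cs p q k
  token-quotient nil = quotient [] [] z≤n λ { here → here }
  token-quotient {p = p} {q} {k} (stay {a , b} {cs} t)
    with quotient ds nl sz fl ← token-quotient t with project p a F.≟ project p b
  -- With `A` represented by `p`, this call has become a loop and is dropped; the saving is not
  -- counted in `k`.
  ... | yes a≡b = quotient ds nl (m≤n⇒m≤1+n sz) λ where
    (skip w) → fl w
    (fwd w) → subst (ds ⊢_⇝ _) (sym a≡b) (fl w)
    (bwd w) → subst (ds ⊢_⇝ _) a≡b (fl w)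
  ... | no a≢b = quotient ((project p a , project p b) ∷ ds) (a≢b ∷ nl) (s≤s sz) λ where
    (skip w) → skip (fl w)
    (fwd w) → fwd (fl w)
    (bwd w) → bwd (fl w)
  token-quotient (move {a} {b} {cs} {q} a≢b t) with quotient ds nl sz fl ← token-quotient t =
    quotient ((a , b) ∷ ds) (a≢b ∷ nl) (s≤s sz) step-flow
    where
    step-flow : ∀ {x y} → ((↑ a , ↑ b) ∷ cs) ⊢ x ⇝ y → ((a , b) ∷ ds) ⊢ project a x ⇝ project q y
    step-flow {x} {y} (skip w) with side x
    -- The image of `A` moves from `a` to `b`, so a walk waiting at `A` turns into one that takes
    -- the call.
    ... | self = subst (_ ⊢_⇝ _) (sym (project-self a)) (fwd (subst (ds ⊢_⇝ _) (project-self b) (fl w)))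
    ... | other z = subst (_ ⊢_⇝ _) (sym (project-other a z)) (skip (subst (ds ⊢_⇝ _) (project-other b z) (fl w)))
    step-flow (fwd w) = subst (_ ⊢_⇝ _) (sym (project-other a a)) (fwd (subst (ds ⊢_⇝ _) (project-other b b) (fl w)))
    step-flow (bwd w) = subst (_ ⊢_⇝ _) (sym (project-other a b)) (bwd (subst (ds ⊢_⇝ _) (project-other b a) (fl w)))
  token-quotient (move′ {a} {b} {cs} {q} a≢b t) with quotient ds nl sz fl ← token-quotient t =
    quotient ((a , b) ∷ ds) (a≢b ∷ nl) (s≤s sz) step-flow
    where
    step-flow : ∀ {x y} → ((↑ a , ↑ b) ∷ cs) ⊢ x ⇝ y → ((a , b) ∷ ds) ⊢ project b x ⇝ project q y
    step-flow {x} {y} (skip w) with side x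
    ... | self = subst (_ ⊢_⇝ _) (sym (project-self b)) (bwd (subst (ds ⊢_⇝ _) (project-self a) (fl w)))
    ... | other z = subst (_ ⊢_⇝ _) (sym (project-other b z)) (skip (subst (ds ⊢_⇝ _) (project-other a z) (fl w)))
    step-flow (fwd w) = subst (_ ⊢_⇝ _) (sym (project-other b a)) (fwd (subst (ds ⊢_⇝ _) (project-other a b) (fl w)))
    step-flow (bwd w) = subst (_ ⊢_⇝ _) (sym (project-other b b)) (bwd (subst (ds ⊢_⇝ _) (project-other a a) (fl w)))
  -- Both ends of this call have the image `p`, so the call is saved.
  token-quotient {p = p} {k = suc k} (meet t) with quotient ds nl sz fl ← token-quotient t =
    quotient ds nl (≤-trans (≤-reflexive (+-suc (length ds) k)) (s≤s sz)) λ where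
    (skip w) → fl w
    (fwd w) → subst (ds ⊢_⇝ _) (trans (project-other p p) (sym (project-self p))) (fl w)
    (bwd w) → subst (ds ⊢_⇝ _) (trans (project-self p) (sym (project-other p p))) (fl w)
  token-quotient {p = p} {k = suc k} (meet′ t) with quotient ds nl sz fl ← token-quotient t =
    quotient ds nl (≤-trans (≤-reflexive (+-suc (length ds) k)) (s≤s sz)) λ where
    (skip w) → fl w
    (fwd w) → subst (ds ⊢_⇝ _) (trans (project-self p) (sym (project-other p p))) (fl w)
    (bwd w) → subst (ds ⊢_⇝ _) (trans (project-other p p) (sym (project-self p))) (fl w)

  -- One walk runs in the reversed past and one in the future, both starting at `y`. Each yields a
  -- token with one meeting; glued at `y` they form a token with two, so two calls disappear
  -- together with `A`.
  delete : ∀ {rpre post y} → All NoLoop rpre → All NoLoop post → Complete (rpre ʳ++ post) →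
           A ≢ y → rpre ⊢ y ⇝ A → post ⊢ y ⇝ A →
           ∃[ ds ] (All NoLoop ds × Complete {n} ds × length ds + 2 ≤ length (rpre ʳ++ post))
  delete {rpre} {post} {y} nl nl′ comp A≢y w w′
    with side y
  ... | self = contradiction refl A≢y
  ... | other z with p , t ← token-meets nl w z refl | q , u ← token-meets nl′ w′ z refl
    with quotient ds nlds sz fl ← token-quotient (token-ʳ++ t u) =
    ds , nlds , (λ x x′ → subst₂ (ds ⊢_⇝_) (project-other p x) (project-other q x′) (fl (comp (↑ x) (↑ x′)))) , sz

-- The gossip inequality

-- The same cut seen in reversed time: past and future trade places.
reverse-zipper : ∀ {A : Set} (xs : List A) {ys zs} → xs ʳ++ ys ≡ zs → ys ʳ++ xs ≡ reverse zs
reverse-zipper xs {ys} refl = trans (cong (ys ʳ++_) (sym (++-identityʳ xs))) (sym (ʳ++-ʳ++ xs))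

xor-true : ∀ p {q} → p xor q ≡ true → p ≡ true ⊎ q ≡ true
xor-true true _ = inj₁ refl
xor-true false q = inj₂ q

module _ {n : ℕ} where

  private
    Calls : Set
    Calls = Multigraph n

  count : Fin n → Calls → ℕ
  count A cs = total (λ x → ⟦ reaches A cs x ⟧)

  -- On a reversed past this says that the call tells one participant about `A`; on a future, that
  -- it opens a route to `A` for a participant that has none.
  news : Fin n → Fin n × Fin n → Calls → Bool
  news A (a , b) cs = reaches A cs a xor reaches A cs b

  count-step : ∀ A {a b} cs → a ≢ b → count A ((a , b) ∷ cs) ≤ count A cs + ⟦ news A (a , b) cs ⟧
  count-step A {a} {b} cs a≢b = begin
    total (λ x → ⟦ r x ∨ (hit (a , b) x ∧ (r a ∨ r b)) ⟧)
      ≤⟨ total-mono (λ x → pointwise (r x) (hit (a , b) x) (r a ∨ r b)) ⟩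
    total (λ x → ⟦ r x ⟧ + ⟦ hit (a , b) x ∧ g x ⟧)
      ≡⟨ total-+ (λ x → ⟦ r x ⟧) (λ x → ⟦ hit (a , b) x ∧ g x ⟧) ⟩
    count A cs + total (λ x → ⟦ hit (a , b) x ∧ g x ⟧)
      ≡⟨ cong (count A cs +_) (trans (total-hit a≢b g) (cases (r a) (r b))) ⟩
    count A cs + ⟦ r a xor r b ⟧ ∎
    where
    open ≤-Reasoning
    r = reaches A cs
    g : Fin n → Bool
    g x = not (r x) ∧ (r a ∨ r b)
    pointwise : ∀ p h q → ⟦ p ∨ (h ∧ q) ⟧ ≤ ⟦ p ⟧ + ⟦ h ∧ (not p ∧ q) ⟧
    pointwise true h q = s≤s z≤n
    pointwise false h q = ≤-refl
    cases : ∀ p q → ⟦ not p ∧ (p ∨ q) ⟧ + ⟦ not q ∧ (p ∨ q) ⟧ ≡ ⟦ p xor q ⟧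
    cases true true = refl
    cases true false = refl
    cases false true = refl
    cases false false = refl

  count-[] : ∀ A → count A [] ≡ 1
  count-[] A = trans (total-cong λ x → sym (ind≡ A x)) (total-ind A)

  count-complete : ∀ A {cs} → Complete cs → count A cs ≡ n
  count-complete A comp =
    trans (total-cong λ x → cong ⟦_⟧ (⇝⇒reaches (comp x A))) (trans (total-const n 1) (*-identityʳ n))

  -- No closed walk through A passes from the reversed prefix rpre to the suffix post.
  Silent : Fin n → Calls → Calls → Set
  Silent A rpre post = ∀ y → reaches A rpre y ≡ true → reaches A post y ≡ true → A ≡ y

  NeverHears : Fin n → Calls → Set
  NeverHears A cs = ∀ rpre post → rpre ʳ++ post ≡ cs → Silent A rpre post

  -- If the call is news in both directions, a participant informed of `A` has a route back to `A`
  -- from this call on. Silence identifies it with `A`, and the term counting `A` in the call pays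
  -- for the second piece of news.
  call-bound : ∀ {A a b} rpre post → a ≢ b → Silent A rpre ((a , b) ∷ post) →
               ⟦ news A (a , b) rpre ⟧ + ⟦ news A (a , b) post ⟧ ≤ 1 + (ind a A + ind b A)
  call-bound {A} {a} {b} rpre post a≢b sil rewrite ind-call≡hit a≢b A
    with news A (a , b) rpre in out | news A (a , b) post in inn
  ... | false | q = ≤-trans (⟦⟧≤1 q) (m≤m+n 1 _)
  ... | true | false = m≤m+n 1 _
  ... | true | true = s≤s (≤-reflexive (sym (cong ⟦_⟧ A-calls)))
    where
    back : ∀ x → hit (a , b) x ≡ true → reaches A ((a , b) ∷ post) x ≡ true
    back x hx with xor-true (reaches A post a) inn
    ... | inj₁ p = reaches-call post hx (hit₁ a b) p
    ... | inj₂ p = reaches-call post hx (hit₂ a b) p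
    A-calls : hit (a , b) A ≡ true
    A-calls with xor-true (reaches A rpre a) out
    ... | inj₁ p = subst (λ y → hit (a , b) y ≡ true) (sym (sil a p (back a (hit₁ a b)))) (hit₁ a b)
    ... | inj₂ p = subst (λ y → hit (a , b) y ≡ true) (sym (sil b p (back b (hit₂ a b)))) (hit₂ a b)

  -- `call-bound` summed over `seg`: the forward count grows from `rpre`, the backward count from
  -- the empty list, where it is 1. An arbitrary `rpre` allows a list to be treated in two pieces
  -- with one call left out.
  segment-bound : ∀ {A} seg rpre → All NoLoop seg →
                  (∀ xs ys → xs ++ ys ≡ seg → Silent A (xs ʳ++ rpre) ys) →
                  count A (seg ʳ++ rpre) + count A seg ≤ count A rpre + 1 + (length seg + deg seg A)
  segment-bound {A} [] rpre nl sil = ≤-reflexive (trans (cong (count A rpre +_) (count-[] A)) (sym (+-identityʳ _)))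
  segment-bound {A} ((a , b) ∷ seg) rpre (a≢b ∷ nl) sil =
    ≤-by 0
      (+-mono-≤ (+-mono-≤ (count-step A seg a≢b)
                          (segment-bound seg ((a , b) ∷ rpre) nl (λ xs ys e → sil ((a , b) ∷ xs) ys (cong (_ ∷_) e))))
                (+-mono-≤ (count-step A rpre a≢b) (call-bound rpre seg a≢b (sil [] _ refl))))
      (lemma (count A (seg ʳ++ (a , b) ∷ rpre)) (count A seg) (count A ((a , b) ∷ seg)) (count A ((a , b) ∷ rpre))
        (count A rpre) ⟦ news A (a , b) rpre ⟧ ⟦ news A (a , b) seg ⟧ (length seg) (deg seg A) (ind a A + ind b A))
    where
    lemma : ∀ X Y Y′ R′ R k s l d i →
            X + Y′ + ((Y + s) + (R′ + 1 + (l + d)) + (R + k + (1 + i))) + 0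
            ≡ (R + 1 + (suc l + (i + d))) + (Y′ + (X + Y) + (R′ + (k + s)))
    lemma = solve-∀

  module _ {A : Fin n} {cs : Calls} (noLoop : All NoLoop cs) (complete : Complete cs) (silent : NeverHears A cs) where

    private
      count-reverse : count A (reverse cs) ≡ n
      count-reverse = count-complete A (λ x y → ⇝-ʳ++ (complete y x) here)

    -- Over the whole list both counts start at 1 and end at `n`.
    length+deg : 2 * n ≤ 2 + (length cs + deg cs A)
    length+deg = begin
      2 * n                            ≡⟨ cong (n +_) (+-identityʳ n) ⟩
      n + n                            ≡⟨ cong₂ _+_ (sym count-reverse) (sym (count-complete A complete)) ⟩
      count A (reverse cs) + count A cs
        ≤⟨ segment-bound cs [] noLoop (λ xs ys e → silent (xs ʳ++ []) ys (trans (ʳ++-ʳ++ xs) e)) ⟩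
      count A [] + 1 + (length cs + deg cs A) ≡⟨ cong (λ k → k + 1 + (length cs + deg cs A)) (count-[] A) ⟩
      2 + (length cs + deg cs A)       ∎
      where open ≤-Reasoning

    -- The bound improves on `length+deg` by 1 because the call can be left out: `before` and
    -- `after` treat the remaining pieces, the former in reversed time, and by `no-news` the call
    -- raises neither count.
    useless-call : ∀ rpre {a b} post → rpre ʳ++ (a , b) ∷ post ≡ cs →
                   news A (a , b) rpre ≡ false → news A (a , b) post ≡ false →
                   2 * n ≤ 1 + (length cs + deg cs A)
    useless-call rpre {a} {b} post e out inn =
      ≤-by (ind a A + ind b A)
        (+-mono-≤ (+-mono-≤ before after) (+-mono-≤ (no-news rpre out) (no-news post inn)))
        (trans (lemma n (count A rpre) (count A post) (count A (c ∷ rpre)) (count A (c ∷ post)) (length rpre) (length post)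
                      (deg rpre A) (deg post A) (ind a A + ind b A))
           (cong₂ (λ l d → 1 + (l + d) + (n + count A rpre + (n + count A post) + (count A (c ∷ rpre) + count A (c ∷ post))))
              (sym len) (sym dg)))
      where
      c = a , b
      a≢b : a ≢ b
      a≢b with p ∷ _ ← NoLoop-ʳ++⁻ rpre (subst (All NoLoop) (sym e) noLoop) = p
      nl-post : All NoLoop post
      nl-post with _ ∷ p ← NoLoop-ʳ++⁻ rpre (subst (All NoLoop) (sym e) noLoop) = p
      e′ : post ʳ++ c ∷ rpre ≡ reverse cs
      e′ = reverse-zipper rpre e
      nl-rpre : All NoLoop rpre
      nl-rpre with _ ∷ p ← NoLoop-ʳ++⁻ post (subst (All NoLoop) (sym e′) (NoLoop-ʳ++ noLoop [])) = p
      no-news : ∀ xs → news A c xs ≡ false → count A (c ∷ xs) ≤ count A xs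
      no-news xs eq = ≤-trans (count-step A xs a≢b) (≤-reflexive (trans (cong (λ t → count A xs + ⟦ t ⟧) eq) (+-identityʳ _)))
      before : n + count A rpre ≤ count A (c ∷ post) + 1 + (length rpre + deg rpre A)
      before = subst (λ k → k + count A rpre ≤ count A (c ∷ post) + 1 + (length rpre + deg rpre A)) (trans (cong (count A) e) (count-complete A complete))
        (segment-bound rpre (c ∷ post) nl-rpre λ xs ys eq y p q →
          silent ys (xs ʳ++ (c ∷ post)) (trans (sym (++-ʳ++ xs)) (trans (cong (_ʳ++ c ∷ post) eq) e)) y q p)
      after : n + count A post ≤ count A (c ∷ rpre) + 1 + (length post + deg post A)
      after = subst (λ k → k + count A post ≤ count A (c ∷ rpre) + 1 + (length post + deg post A)) (trans (cong (count A) e′) count-reverse)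
        (segment-bound post (c ∷ rpre) nl-post λ xs ys eq →
          silent (xs ʳ++ (c ∷ rpre)) ys (trans (ʳ++-ʳ++ xs) (trans (cong ((c ∷ rpre) ʳ++_) eq) e)))
      len : length cs ≡ length rpre + suc (length post)
      len = trans (cong length (sym e)) (length-ʳ++ rpre)
      dg : deg cs A ≡ deg rpre A + (ind a A + ind b A + deg post A)
      dg = trans (cong (λ l → deg l A) (sym e)) (deg-ʳ++ rpre (c ∷ post) A)
      lemma : ∀ n R P R′ P′ lr lp dr dp i →
        2 * n + (P′ + 1 + (lr + dr) + (R′ + 1 + (lp + dp)) + (R + P)) + i
        ≡ 1 + (lr + suc lp + (dr + (i + dp))) + (n + R + (n + P) + (R′ + P′))
      lemma = solve-∀

-- Useful calls, last calls and first calls.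

module _ {n : ℕ} where

  private
    Calls : Set
    Calls = Multigraph n

  occ-false-reaches : ∀ {D x} (xs ys : Calls) → occ xs x ≡ false → reaches D (xs ʳ++ ys) x ≡ true → reaches D ys x ≡ true
  occ-false-reaches [] ys o p = p
  occ-false-reaches {D} {x} (c ∷ xs) ys o p with hit c x in h
  ... | false with reaches-call⁻ ys {x} (occ-false-reaches xs (c ∷ ys) o p)
  ...   | inj₁ q = q
  ...   | inj₂ (_ , h′ , _) with () ← trans (sym h) h′

  occ-false-idle : ∀ {A x} (cs : Calls) → occ cs x ≡ false → reaches A cs x ≡ true → A ≡ x
  occ-false-idle {A} {x} [] o p = ==⇒≡ A x p
  occ-false-idle {A} {x} (c ∷ cs) o p with reaches-call⁻ cs {x} p
  ... | inj₂ (_ , h , _) with () ← trans (sym o) (∨-trueˡ h)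
  ... | inj₁ q with hit c x
  ...   | false = occ-false-idle cs o q

  occ-neighbour : ∀ {x} {cs : Calls} → All NoLoop cs → occ cs x ≡ true → ∃[ D ] (D ≢ x × reaches D cs x ≡ true)
  occ-neighbour {x} {(a , b) ∷ cs} (a≢b ∷ nl) o with ∨-elim (hit (a , b) x) o
  ... | inj₂ o′ with D , D≢x , r ← occ-neighbour nl o′ = D , D≢x , reaches-skip {c = a , b} {cs} {x} r
  ... | inj₁ h with hit-elim a b x h
  ...   | inj₁ refl = b , a≢b ∘ sym , ⇝⇒reaches (fwd (⇝-refl cs))
  ...   | inj₂ refl = a , a≢b , ⇝⇒reaches (bwd (⇝-refl cs))

  record Gossip (cs : Calls) : Set where
    field
      noLoop   : All NoLoop cs
      complete : Complete cs
      silent   : ∀ A → NeverHears A cs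

    noLoop-suffix : ∀ rpre {post} → rpre ʳ++ post ≡ cs → All NoLoop post
    noLoop-suffix rpre e = NoLoop-ʳ++⁻ rpre (subst (All NoLoop) (sym e) noLoop)

    -- After its last call a knows everything, hence so does its partner b, and any
    -- later call of b would tell somebody its own information.
    last-call : ∀ rpre {a b x y} post → rpre ʳ++ (a , b) ∷ post ≡ cs →
                hit (a , b) x ≡ true → hit (a , b) y ≡ true → occ post x ≡ false → occ post y ≡ false
    last-call rpre {a} {b} {x} {y} post e hx hy o with occ post y in o′
    ... | false = refl
    ... | true with _ ∷ nl ← noLoop-suffix rpre e with D , D≢y , r ← occ-neighbour nl o′ =
      contradiction (silent D ((a , b) ∷ rpre) post e y y-informed r) D≢y
      where
      x-informed : reaches D ((a , b) ∷ rpre) x ≡ true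
      x-informed = occ-false-reaches {D} {x} post ((a , b) ∷ rpre) o
        (subst (λ l → reaches D l x ≡ true) (sym (reverse-zipper rpre e)) (⇝⇒reaches (⇝-ʳ++ (complete D x) here)))
      y-informed : reaches D ((a , b) ∷ rpre) y ≡ true
      y-informed with reaches-call⁻ rpre {x} x-informed
      ... | inj₁ p = reaches-call rpre hy hx p
      ... | inj₂ (_ , _ , hz , p) = reaches-call rpre hy hz p

  -- Time reversal exchanges being informed of `A` with being heard by `A`, and last calls with
  -- first calls, so each fact about last calls has a dual.
  Gossip-reverse : ∀ {cs} → Gossip cs → Gossip (reverse cs)
  Gossip-reverse {cs} g = record
    { noLoop = NoLoop-ʳ++ noLoop []
    ; complete = λ x y → ⇝-ʳ++ (complete y x) here
    ; silent = λ A rpre post e y p q →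
        silent A post rpre (trans (reverse-zipper rpre e) (reverse-involutive cs)) y q p
    }
    where open Gossip g

  -- early A rpre post x is 1 if x has calls in post and is informed of A before the last
  -- of them; late A rpre post x is 1 if it has calls in post but is not so informed.
  early late : Fin n → Calls → Calls → Seq n
  early A rpre [] x = 0
  early A rpre (c ∷ post) x = early A (c ∷ rpre) post x + ⟦ hit c x ∧ (not (occ post x) ∧ reaches A rpre x) ⟧
  late A rpre [] x = 0
  late A rpre (c ∷ post) x = late A (c ∷ rpre) post x + ⟦ hit c x ∧ (not (occ post x) ∧ not (reaches A rpre x)) ⟧

  early+late : ∀ A rpre post x → early A rpre post x + late A rpre post x ≡ ⟦ occ post x ⟧
  early+late A rpre [] x = refl
  early+late A rpre (c ∷ post) x =
    trans (shuffle (early A (c ∷ rpre) post x) _ (late A (c ∷ rpre) post x) _)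
      (trans (cong (_+ (⟦ hit c x ∧ (not (occ post x) ∧ reaches A rpre x) ⟧
                        + ⟦ hit c x ∧ (not (occ post x) ∧ not (reaches A rpre x)) ⟧))
                   (early+late A (c ∷ rpre) post x))
             (cases (hit c x) (occ post x) (reaches A rpre x)))
    where
    shuffle : ∀ p q r s → p + q + (r + s) ≡ p + r + (q + s)
    shuffle = solve-∀
    cases : ∀ h o r → ⟦ o ⟧ + (⟦ h ∧ (not o ∧ r) ⟧ + ⟦ h ∧ (not o ∧ not r) ⟧) ≡ ⟦ h ∨ o ⟧
    cases true true r = refl
    cases true false true = refl
    cases true false false = refl
    cases false true r = refl
    cases false false r = refl

  -- Information is never lost, so what is known while calls are still to come is known before the
  -- last of them.
  early-informed : ∀ A {x} rpre post → occ post x ≡ true → reaches A rpre x ≡ true → 1 ≤ early A rpre post x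
  early-informed A {x} rpre (c ∷ post) o r with occ post x in o′
  ... | true = ≤-trans (early-informed A (c ∷ rpre) post o′ (reaches-skip {c = c} {rpre} {x} r)) (m≤m+n _ _)
  ... | false with hit c x
  ...   | true rewrite r = m≤n+m 1 _
  early-informed A {x} rpre (c ∷ post) () r | false | false

  early-shift : ∀ A rpre post x → early A rpre post x ≤ early A [] (rpre ʳ++ post) x
  early-shift A [] post x = ≤-refl
  early-shift A (c ∷ rpre) post x = ≤-trans (m≤m+n _ _) (early-shift A rpre (c ∷ post) x)

  private
    Useful : Fin n → Calls → Set
    Useful A cs = ∀ rpre a b post → rpre ʳ++ (a , b) ∷ post ≡ cs →
                  news A (a , b) rpre ≡ true ⊎ news A (a , b) post ≡ true

  -- A useful last call informs exactly one of its two participants.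
  early≤late : ∀ {A cs} → Gossip cs → Useful A cs → ∀ rpre post → rpre ʳ++ post ≡ cs →
               total (early A rpre post) ≤ total (late A rpre post)
  early≤late g u rpre [] e = ≤-refl
  early≤late {A} {cs} g u rpre ((a , b) ∷ post) e = begin
    total (early A rpre (c ∷ post))
      ≡⟨ trans (total-+ (early A (c ∷ rpre) post) _) (cong (total (early A (c ∷ rpre) post) +_) (total-hit a≢b _)) ⟩
    total (early A (c ∷ rpre) post) + (⟦ not (occ post a) ∧ reaches A rpre a ⟧ + ⟦ not (occ post b) ∧ reaches A rpre b ⟧)
      ≤⟨ +-mono-≤ (early≤late g u (c ∷ rpre) post e) call ⟩
    total (late A (c ∷ rpre) post) +
    (⟦ not (occ post a) ∧ not (reaches A rpre a) ⟧ + ⟦ not (occ post b) ∧ not (reaches A rpre b) ⟧)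
      ≡⟨ trans (total-+ (late A (c ∷ rpre) post) _) (cong (total (late A (c ∷ rpre) post) +_) (total-hit a≢b _)) ⟨
    total (late A rpre (c ∷ post)) ∎
    where
    open ≤-Reasoning
    open Gossip g
    c = a , b
    a≢b : a ≢ b
    a≢b with p ∷ _ ← noLoop-suffix rpre e = p
    informs : occ post a ≡ false → occ post b ≡ false → news A c rpre ≡ true
    informs oa ob with u rpre a b post e
    ... | inj₁ out = out
    ... | inj₂ inn with xor-true (reaches A post a) inn
    -- Neither participant calls again, so one that still reaches `A` is `A` itself. Its partner
    -- cannot be informed of `A` already, since this call would bring that information back to `A`.
    ...   | inj₁ ra with refl ← occ-false-idle post oa ra
      rewrite ⇝⇒reaches (⇝-refl rpre {A}) with reaches A rpre b in rb
    ...     | false = refl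
    ...     | true = contradiction (silent A rpre (c ∷ post) e b rb (reaches-call post (hit₂ a b) (hit₁ a b) ra)) a≢b
    informs oa ob | inj₂ inn | inj₂ rb with refl ← occ-false-idle post ob rb
      rewrite ⇝⇒reaches (⇝-refl rpre {A}) with reaches A rpre a in ra
    ...     | false = refl
    ...     | true = contradiction (sym (silent A rpre (c ∷ post) e a ra (reaches-call post (hit₁ a b) (hit₂ a b) rb))) a≢b
    call : ⟦ not (occ post a) ∧ reaches A rpre a ⟧ + ⟦ not (occ post b) ∧ reaches A rpre b ⟧
         ≤ ⟦ not (occ post a) ∧ not (reaches A rpre a) ⟧ + ⟦ not (occ post b) ∧ not (reaches A rpre b) ⟧
    call with occ post a in oa | occ post b in ob
    ... | true | true = z≤n
    -- By `last-call` the call is the last one for both participants or for neither.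
    ... | true | false with () ← trans (sym oa) (last-call rpre post e (hit₂ a b) (hit₁ a b) ob)
    ... | false | true with () ← trans (sym ob) (last-call rpre post e (hit₁ a b) (hit₂ a b) oa)
    ... | false | false = cases (reaches A rpre a) (reaches A rpre b) (informs oa ob)
      where
      cases : ∀ p q → p xor q ≡ true → ⟦ p ⟧ + ⟦ q ⟧ ≤ ⟦ not p ⟧ + ⟦ not q ⟧
      cases true false _ = ≤-refl
      cases false true _ = ≤-refl

  2early≤n : ∀ {A cs} → Gossip cs → Useful A cs → 2 * total (early A [] cs) ≤ n
  2early≤n {A} {cs} g u = begin
    2 * E                          ≡⟨ cong (E +_) (+-identityʳ E) ⟩
    E + E                          ≤⟨ +-monoʳ-≤ E (early≤late g u [] cs refl) ⟩
    E + total (late A [] cs)       ≡⟨ total-+ (early A [] cs) (late A [] cs) ⟨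
    total (λ x → early A [] cs x + late A [] cs x)
      ≤⟨ total-mono (λ x → ≤-trans (≤-reflexive (early+late A [] cs x)) (⟦⟧≤1 (occ cs x))) ⟩
    total {n} (λ _ → 1)            ≡⟨ trans (total-const n 1) (*-identityʳ n) ⟩
    n                              ∎
    where
    open ≤-Reasoning
    E = total (early A [] cs)

  record MiddleCall (cs : Calls) (x : Fin n) : Set where
    constructor middle
    field
      rpre  : Calls
      a b   : Fin n
      post  : Calls
      split : rpre ʳ++ (a , b) ∷ post ≡ cs
      calls : hit (a , b) x ≡ true
      before : occ rpre x ≡ true
      after  : occ post x ≡ true

  -- The alternatives record the progress of the scan: with a call of `x` behind, two must remain,
  -- the middle one and a later one; otherwise three must remain.
  middle-call : ∀ {x cs} rpre post → All NoLoop post → rpre ʳ++ post ≡ cs →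
                (occ rpre x ≡ true × 2 ≤ deg post x) ⊎ 3 ≤ deg post x → MiddleCall cs x
  middle-call rpre [] nl e (inj₁ (_ , ()))
  middle-call rpre [] nl e (inj₂ ())
  middle-call {x} rpre ((a , b) ∷ post) (a≢b ∷ nl) e p rewrite ind-call≡hit a≢b x with hit (a , b) x in h | p
  ... | false | inj₁ (o , d) = middle-call ((a , b) ∷ rpre) post nl e (inj₁ (∨-trueʳ {hit (a , b) x} o , d))
  ... | false | inj₂ d = middle-call ((a , b) ∷ rpre) post nl e (inj₂ d)
  ... | true | inj₁ (o , s≤s d) = middle rpre a b post e h o (deg⇒occ nl d)
  ... | true | inj₂ (s≤s d) = middle-call ((a , b) ∷ rpre) post nl e (inj₁ (∨-trueˡ h , d))

  -- A vertex x that is neither informed of A before its last call nor heard by A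
  -- unless through its first call has only useless calls in between.
  some-call-useless : ∀ {A cs} → Gossip cs → Useful A cs → Useful A (reverse cs) → (∀ x → 3 ≤ deg cs x) → ⊥
  some-call-useless {A} {cs} g u u′ d =
    absurd-by 1 (+-mono-≤ (*-monoʳ-≤ 2 total≥) (+-mono-≤ (2early≤n g u) (2early≤n (Gossip-reverse g) u′)))
      (lemma n (total (early A [] cs)) (total (early A [] (reverse cs))))
    where
    open Gossip g
    lemma : ∀ n E E′ → 2 * (E + E′) + (n + n) + 2 ≡ 2 * (n + 1) + (2 * E + 2 * E′)
    lemma = solve-∀
    either : ∀ x → 1 ≤ early A [] cs x + early A [] (reverse cs) x
    either x with middle rpre a b post e h o o′ ← middle-call [] cs noLoop refl (inj₂ (d x)) with u rpre a b post e
    ... | inj₁ out = ≤-trans (≤-trans early≥1 (≤-trans (early-shift A ((a , b) ∷ rpre) post x) (≤-reflexive (cong (λ l → early A [] l x) e)))) (m≤m+n _ _)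
      where
      informed : reaches A ((a , b) ∷ rpre) x ≡ true
      informed with xor-true (reaches A rpre a) out
      ... | inj₁ p = reaches-call rpre h (hit₁ a b) p
      ... | inj₂ p = reaches-call rpre h (hit₂ a b) p
      early≥1 = early-informed A ((a , b) ∷ rpre) post o′ informed
    ... | inj₂ inn = ≤-trans (≤-trans early≥1 (≤-trans (early-shift A ((a , b) ∷ post) rpre x) (≤-reflexive (cong (λ l → early A [] l x) (reverse-zipper rpre e))))) (m≤n+m _ _)
      where
      informed : reaches A ((a , b) ∷ post) x ≡ true
      informed with xor-true (reaches A post a) inn
      ... | inj₁ p = reaches-call post h (hit₁ a b) p
      ... | inj₂ p = reaches-call post h (hit₂ a b) p
      early≥1 = early-informed A ((a , b) ∷ post) rpre o informed
    self-informed : ∀ {ds} → Gossip ds → 1 ≤ deg ds A → 1 ≤ early A [] ds A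
    self-informed {ds} g′ d′ = early-informed A [] ds (deg⇒occ (Gossip.noLoop g′) d′) (==-refl A)
    -- `A` knows its own information in both directions of time and so counts twice. This raises the
    -- sum to n + 1, whereas each direction contributes at most n / 2.
    pointwise : ∀ x → 1 + ind A x ≤ early A [] cs x + early A [] (reverse cs) x
    pointwise x with A F.≟ x
    ... | no _ = either x
    ... | yes refl = +-mono-≤ (self-informed g (≤-trans (s≤s z≤n) (d A)))
      (self-informed (Gossip-reverse g) (≤-trans (s≤s z≤n) (≤-trans (d A) (≤-reflexive (sym (trans (deg-ʳ++ cs [] A) (+-identityʳ _)))))))
    total≥ : n + 1 ≤ total (early A [] cs) + total (early A [] (reverse cs))
    total≥ = begin
      n + 1                                        ≡⟨ cong₂ _+_ (trans (total-const n 1) (*-identityʳ n)) (total-ind A) ⟨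
      total {n} (λ _ → 1) + total (ind A)          ≡⟨ total-+ (λ _ → 1) (ind A) ⟨
      total (λ x → 1 + ind A x)                    ≤⟨ total-mono pointwise ⟩
      total (λ x → early A [] cs x + early A [] (reverse cs) x) ≡⟨ total-+ (early A [] cs) _ ⟩
      total (early A [] cs) + total (early A [] (reverse cs)) ∎
      where open ≤-Reasoning

  -- Contrapositive of `useless-call`.
  short-useful : ∀ {A cs} → Gossip cs → 2 + (length cs + deg cs A) ≤ 2 * n → Useful A cs
  short-useful {A} {cs} g short rpre a b post e
    with news A (a , b) rpre in out | news A (a , b) post in inn
  ... | true | _ = inj₁ refl
  ... | false | true = inj₂ refl
  ... | false | false =
    contradiction (≤-trans short (useless-call noLoop complete (silent A) rpre post e out inn)) 1+n≰n
    where open Gossip g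

  gossip-bound : ∀ {cs} → Gossip cs → 2 * n ≤ length cs + 4
  gossip-bound {cs} g with 2 * n ≤? length cs + 4
  ... | yes p = p
  ... | no ¬p = ⊥-elim (some-call-useless g (short-useful g short) (short-useful (Gossip-reverse g) short′) deg≥3)
    where
    open Gossip g
    m = length cs
    m+5≤2n : suc (m + 4) ≤ 2 * n
    m+5≤2n = ≰⇒> ¬p
    -- m + deg x is at least 2n - 2, while m is at most 2n - 5.
    deg≥3 : ∀ x → 3 ≤ deg cs x
    deg≥3 x = ≤-by 0 (+-mono-≤ m+5≤2n (length+deg noLoop complete (silent x))) (lemma m (deg cs x) (2 * n))
      where
      lemma : ∀ m d k → 3 + (k + (2 + (m + d))) + 0 ≡ d + (suc (m + 4) + k)
      lemma = solve-∀
    -- The average degree is below 4, and a vertex of degree at most 3 makes m + deg A small enough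
    -- for every call to be useful.
    small : ∃[ A ] deg cs A ≤ 3
    small with any? (λ A → deg cs A ≤? 3)
    ... | yes p = p
    ... | no none = ⊥-elim (absurd-by 9 (+-mono-≤ 4n≤2m (*-monoʳ-≤ 2 m+5≤2n)) (lemma m n))
      where
      4n≤2m : n * 4 ≤ 2 * m
      4n≤2m = begin
        n * 4                ≡⟨ total-const n 4 ⟨
        total {n} (λ _ → 4)  ≤⟨ total-mono (λ A → ≰⇒> (λ d → none (A , d))) ⟩
        total (deg cs)       ≡⟨ total-deg cs ⟩
        2 * m                ∎
        where open ≤-Reasoning
      lemma : ∀ m n → 2 * m + 2 * (2 * n) + 10 ≡ n * 4 + 2 * suc (m + 4)
      lemma = solve-∀
    A = proj₁ small
    short : 2 + (m + deg cs A) ≤ 2 * n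
    short = ≤-by 0 (+-mono-≤ m+5≤2n (proj₂ small)) (lemma m (deg cs A) (2 * n))
      where
      lemma : ∀ m d k → 2 + (m + d) + (k + 3) + 0 ≡ k + (suc (m + 4) + d)
      lemma = solve-∀
    short′ : 2 + (length (reverse cs) + deg (reverse cs) A) ≤ 2 * n
    short′ = ≤-trans (≤-reflexive (cong₂ (λ l d → 2 + (l + d)) (length-reverse cs) (trans (deg-ʳ++ cs [] A) (+-identityʳ _)))) short

-- Induction on `n`. Deleting a vertex that hears itself lowers 2n by 2 and the number of calls by
-- at least 2, so the bound carries over; if there is no such vertex, `gossip-bound` applies.
length-bound : ∀ n (cs : Multigraph n) → All NoLoop cs → Complete cs → 2 * n ≤ length cs + 4
length-bound zero cs nl comp = z≤n
length-bound (suc n) cs nl comp with 2 * suc n ≤? length cs + 4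
... | yes p = p
... | no ¬p = gossip-bound record { noLoop = nl ; complete = comp ; silent = silent }
  where
  silent : ∀ A → NeverHears A cs
  silent A rpre post e y r r′ with A F.≟ y
  ... | yes A≡y = A≡y
  ... | no A≢y with ds , nl′ , comp′ , sz ←
    delete A {rpre} {post}
      (NoLoop-ʳ++⁻ post (subst (All NoLoop) (sym (reverse-zipper rpre e)) (NoLoop-ʳ++ nl [])))
      (NoLoop-ʳ++⁻ rpre (subst (All NoLoop) (sym e) nl))
      (subst Complete (sym e) comp) A≢y (reaches⇒⇝ r) (reaches⇒⇝ r′) =
    contradiction (bound ds comp′ nl′ sz) ¬p
    where
    bound : ∀ ds → Complete ds → All NoLoop ds → length ds + 2 ≤ length (rpre ʳ++ post) → 2 * suc n ≤ length cs + 4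
    bound ds comp′ nl′ sz = ≤-by 0 (+-mono-≤ (length-bound n ds nl′ comp′) sz)
      (trans (lemma n (length ds) (length (rpre ʳ++ post))) (cong (λ l → length l + 4 + _) e))
      where
      lemma : ∀ n d l → 2 * suc n + (d + 4 + l) + 0 ≡ l + 4 + (2 * n + (d + 2))
      lemma = solve-∀

-- Vertices of degree one

module _ {n : ℕ} where

  private
    Calls : Set
    Calls = Multigraph n

  reached-occ : ∀ {cs : Calls} {A y} → A ≢ y → cs ⊢ y ⇝ A → occ cs A ≡ true
  reached-occ A≢y here = contradiction refl A≢y
  reached-occ {c ∷ cs} {A} A≢y (skip p) = ∨-trueʳ {hit c A} (reached-occ A≢y p)
  reached-occ {(a , b) ∷ cs} {A} A≢y (fwd p) with A F.≟ b
  ... | yes refl = ∨-trueˡ (hit₂ a b)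
  ... | no A≢b = ∨-trueʳ {hit (a , b) A} (reached-occ A≢b p)
  reached-occ {(a , b) ∷ cs} {A} A≢y (bwd p) with A F.≟ a
  ... | yes refl = ∨-trueˡ (hit₁ a b)
  ... | no A≢a = ∨-trueʳ {hit (a , b) A} (reached-occ A≢a p)

  -- A closed walk from `A` through another vertex uses a call of `A` before and one after that
  -- vertex. A vertex of degree at most one is therefore silent, and `length+deg` applies.
  leaf-bound : ∀ {cs A} → All NoLoop cs → Complete cs → deg cs A ≤ 1 → 2 * n ≤ 3 + length cs
  leaf-bound {cs} {A} nl comp d = ≤-by 0 (+-mono-≤ (length+deg nl comp silent) d) (lemma (2 * n) (length cs) (deg cs A))
    where
    lemma : ∀ k m d → k + (2 + (m + d) + 1) + 0 ≡ 3 + m + (k + d)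
    lemma = solve-∀
    silent : NeverHears A cs
    silent rpre post e y r r′ with A F.≟ y
    ... | yes A≡y = A≡y
    ... | no A≢y = contradiction two≤deg (<⇒≱ (s≤s d))
      where
      two≤deg : 2 ≤ deg cs A
      two≤deg = begin
        2                      ≤⟨ +-mono-≤ (occ⇒deg (NoLoop-ʳ++⁻ post (subst (All NoLoop) (sym (reverse-zipper rpre e)) (NoLoop-ʳ++ nl [])))
                                                    (reached-occ {rpre} A≢y (reaches⇒⇝ r)))
                                           (occ⇒deg (NoLoop-ʳ++⁻ rpre (subst (All NoLoop) (sym e) nl))
                                                    (reached-occ {post} A≢y (reaches⇒⇝ r′))) ⟩
        deg rpre A + deg post A ≡⟨ deg-ʳ++ rpre post A ⟨
        deg (rpre ʳ++ post) A   ≡⟨ cong (λ l → deg l A) e ⟩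
        deg cs A                ∎
        where open ≤-Reasoning

  hit-occ-false : ∀ {a b x} {cs : Calls} → All NoLoop ((a , b) ∷ cs) → deg ((a , b) ∷ cs) x ≤ 1 →
                  hit (a , b) x ≡ true → occ cs x ≡ false
  hit-occ-false {a} {b} {x} {cs} (a≢b ∷ nl) d h rewrite ind-call≡hit a≢b x | h with occ cs x in o
  ... | false = refl
  ... | true = contradiction (≤-trans (s≤s (occ⇒deg nl o)) d) (λ { (s≤s ()) })

  not-hit : ∀ {a b x y} {cs : Calls} → hit (a , b) x ≡ false → ((a , b) ∷ cs) ⊢ x ⇝ y → cs ⊢ x ⇝ y
  not-hit h (skip p) = p
  not-hit {a} {b} h (fwd p) with () ← trans (sym h) (hit₁ a b)
  not-hit {a} {b} h (bwd p) with () ← trans (sym h) (hit₂ a b)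

  -- Consider the first call of `u` or `w`. If it contains only one of them, that one is finished
  -- and out of reach of the other. So it joins `u` and `w`, both are finished, and `z` is out of
  -- reach.
  two-leaves : ∀ {u w z} {cs : Calls} → All NoLoop cs → deg cs u ≤ 1 → deg cs w ≤ 1 → u ≢ w → z ≢ u → z ≢ w →
               cs ⊢ u ⇝ w → cs ⊢ w ⇝ u → cs ⊢ u ⇝ z → ⊥
  two-leaves {cs = []} nl du dw u≢w z≢u z≢w here ru rz = u≢w refl
  two-leaves {u} {w} {z} {(a , b) ∷ cs} nls@(a≢b ∷ nl) du dw u≢w z≢u z≢w rw ru rz
    with hit (a , b) u in hu | hit (a , b) w in hw
  ... | false | false = two-leaves nl (≤-trans (m≤n+m _ _) du) (≤-trans (m≤n+m _ _) dw) u≢w z≢u z≢w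
                          (not-hit hu rw) (not-hit hw ru) (not-hit hu rz)
  ... | true | false with () ← trans (sym (hit-occ-false nls du hu)) (reached-occ {cs} u≢w (not-hit hw ru))
  ... | false | true with () ← trans (sym (hit-occ-false nls dw hw)) (reached-occ {cs} (u≢w ∘ sym) (not-hit hu rw))
  ... | true | true = after-call rz
    where
    idle : ∀ {y} → occ cs y ≡ false → cs ⊢ y ⇝ z → z ≡ y
    idle o p = occ-false-idle cs o (⇝⇒reaches p)
    after-call : ((a , b) ∷ cs) ⊢ u ⇝ z → ⊥
    after-call (skip p) = z≢u (idle (hit-occ-false nls du hu) p)
    after-call (fwd p) with hit-elim a b w hw
    ... | inj₁ refl = u≢w refl
    ... | inj₂ refl = z≢w (idle (hit-occ-false nls dw hw) p)
    after-call (bwd p) with hit-elim a b w hw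
    ... | inj₁ refl = z≢w (idle (hit-occ-false nls dw hw) p)
    ... | inj₂ refl = u≢w refl

-- From proper labelings to lists of calls

Loopless⇒NoLoop : ∀ {n} (G : Multigraph n) → Loopless G → All NoLoop G
Loopless⇒NoLoop [] ll = []
Loopless⇒NoLoop (c ∷ G) ll = ll F.zero ∷ Loopless⇒NoLoop G (ll ∘ F.suc)

deg-↭ : ∀ {n} {xs ys : Multigraph n} → xs ↭ ys → ∀ v → deg xs v ≡ deg ys v
deg-↭ _↭_.refl v = refl
deg-↭ (prep (a , b) p) v = cong (ind a v + ind b v +_) (deg-↭ p v)
deg-↭ (swap {xs} {ys} (a , b) (a′ , b′) p) v =
  trans (cong (λ k → ind a v + ind b v + (ind a′ v + ind b′ v + k)) (deg-↭ p v))
        (lemma (ind a v + ind b v) (ind a′ v + ind b′ v) (deg ys v))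
  where
  lemma : ∀ p q r → p + (q + r) ≡ q + (p + r)
  lemma = solve-∀
deg-↭ (_↭_.trans p q) v = trans (deg-↭ p v) (deg-↭ q v)

module _ {n : ℕ} where

  private
    Labelled : Set
    Labelled = List (ℕ × (Fin n × Fin n))

  labelled : (G : Multigraph n) → Labeling G → Labelled
  labelled [] l = []
  labelled (c ∷ G) l = (l F.zero , c) ∷ labelled G (l ∘ F.suc)

  labelled-calls : ∀ G (l : Labeling G) → map proj₂ (labelled G l) ≡ G
  labelled-calls [] l = refl
  labelled-calls (c ∷ G) l = cong (c ∷_) (labelled-calls G (l ∘ F.suc))

  ∈-labelled : ∀ G (l : Labeling G) e → (l e , lookup G e) ∈ labelled G l
  ∈-labelled (c ∷ G) l F.zero = here refl
  ∈-labelled (c ∷ G) l (F.suc e) = there (∈-labelled G (l ∘ F.suc) e)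

  insert : ℕ × (Fin n × Fin n) → Labelled → Labelled
  insert x [] = x ∷ []
  insert x (y ∷ ys) with proj₁ x ≤? proj₁ y
  ... | yes _ = x ∷ y ∷ ys
  ... | no _ = y ∷ insert x ys

  sort : Labelled → Labelled
  sort [] = []
  sort (x ∷ xs) = insert x (sort xs)

  insert-↭ : ∀ x ys → insert x ys ↭ x ∷ ys
  insert-↭ x [] = ↭-refl
  insert-↭ x (y ∷ ys) with proj₁ x ≤? proj₁ y
  ... | yes _ = ↭-refl
  ... | no _ = ↭-trans (prep y (insert-↭ x ys)) (swap y x ↭-refl)

  sort-↭ : ∀ xs → sort xs ↭ xs
  sort-↭ [] = ↭-refl
  sort-↭ (x ∷ xs) = ↭-trans (insert-↭ x (sort xs)) (prep x (sort-↭ xs))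

  Sorted : Labelled → Set
  Sorted = AllPairs (λ x y → proj₁ x ≤ proj₁ y)

  insert-sorted : ∀ x {ys} → Sorted ys → Sorted (insert x ys)
  insert-sorted x [] = [] ∷ []
  insert-sorted x {y ∷ ys} (p ∷ ps) with proj₁ x ≤? proj₁ y
  ... | yes x≤y = (x≤y ∷ All.map (≤-trans x≤y) p) ∷ p ∷ ps
  ... | no x≰y = All-resp-↭ (↭-sym (insert-↭ x ys)) (<⇒≤ (≰⇒> x≰y) ∷ p) ∷ insert-sorted x ps

  sort-sorted : ∀ xs → Sorted (sort xs)
  sort-sorted [] = []
  sort-sorted (x ∷ xs) = insert-sorted x (sort-sorted xs)

  -- Steps are recorded by membership in `L`, which survives sorting; the strict bound `t` tells
  -- which entries can no longer be used.
  data Rising (L : Labelled) (t : ℕ) : Fin n → Fin n → Set where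
    stop : ∀ {v} → Rising L t v v
    fwd  : ∀ {l a b v} → (l , (a , b)) ∈ L → t < l → Rising L l b v → Rising L t a v
    bwd  : ∀ {l a b v} → (l , (a , b)) ∈ L → t < l → Rising L l a v → Rising L t b v

  rising-drop : ∀ {x L t u v} → proj₁ x ≤ t → Rising (x ∷ L) t u v → Rising L t u v
  rising-drop x≤t stop = stop
  rising-drop x≤t (fwd (here refl) t<l w) = contradiction x≤t (<⇒≱ t<l)
  rising-drop x≤t (fwd (there m) t<l w) = fwd m t<l (rising-drop (≤-trans x≤t (<⇒≤ t<l)) w)
  rising-drop x≤t (bwd (here refl) t<l w) = contradiction x≤t (<⇒≱ t<l)
  rising-drop x≤t (bwd (there m) t<l w) = bwd m t<l (rising-drop (≤-trans x≤t (<⇒≤ t<l)) w)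

  -- If the next step lies behind the head of the sorted list, the label of the head is at most that
  -- of the step, so the walk never returns to the head and may skip it.
  rising⇒⇝ : ∀ {L t u v} → Sorted L → Rising L t u v → map proj₂ L ⊢ u ⇝ v
  rising⇒⇝ {L} s stop = ⇝-refl (map proj₂ L)
  rising⇒⇝ (p ∷ ps) (fwd (here refl) t<l w) = fwd (rising⇒⇝ ps (rising-drop ≤-refl w))
  rising⇒⇝ (p ∷ ps) (fwd (there m) t<l w) = skip (rising⇒⇝ ps (fwd m t<l (rising-drop (All.lookup p m) w)))
  rising⇒⇝ (p ∷ ps) (bwd (here refl) t<l w) = bwd (rising⇒⇝ ps (rising-drop ≤-refl w))
  rising⇒⇝ (p ∷ ps) (bwd (there m) t<l w) = skip (rising⇒⇝ ps (bwd m t<l (rising-drop (All.lookup p m) w)))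

  module _ (G : Multigraph n) (l : Labeling G) (positive : Positive {G = G} l) (proper : Proper G l) where

    private
      L : Labelled
      L = sort (labelled G l)

      edge∈ : ∀ e → (l e , lookup G e) ∈ L
      edge∈ e = ∈-resp-↭ (↭-sym (sort-↭ (labelled G l))) (∈-labelled G l e)

    rise : ∀ {t u w v} e → Joins G e u w → t < l e → Rising L (l e) w v → Rising L t u v
    rise e (inj₁ (refl , refl)) t<l r = fwd (edge∈ e) t<l r
    rise e (inj₂ (refl , refl)) t<l r = bwd (edge∈ e) t<l r

    head-≢ : ∀ {t u w v} (p : TWalk G l t w v) → All (u ≢_) (verts p) → u ≢ w
    head-≢ stop (u≢w ∷ _) = u≢w
    head-≢ (step _ _ _ _) (u≢w ∷ _) = u≢w

    Joins-sym : ∀ {e u w} → Joins G e u w → Joins G e w u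
    Joins-sym (inj₁ p) = inj₂ p
    Joins-sym (inj₂ p) = inj₁ p

    -- Since a path does not turn back, consecutive edges are distinct, and a proper
    -- labeling then increases strictly along them.
    rising-after : ∀ {u w v} e → Joins G e u w → (p : TWalk G l (l e) w v) →
                   All (u ≢_) (verts p) → Unique (verts p) → Rising L (l e) w v
    rising-after e j stop _ _ = stop
    rising-after {u} {w} e j (step {w = w′} f jf le p) (u≢w ∷ u∉) (w∉ ∷ un) =
      rise f jf (≤∧≢⇒< le (proper e f e≢f (w , (u , Joins-sym {e} j) , (w′ , jf)))) (rising-after f jf p w∉ un)
      where
      u≢w′ : u ≢ w′
      u≢w′ = head-≢ p u∉
      no-turn : Joins G e u w → Joins G e w w′ → ⊥
      no-turn (inj₁ (refl , _)) (inj₁ (refl , _)) = u≢w refl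
      no-turn (inj₁ (refl , _)) (inj₂ (refl , _)) = u≢w′ refl
      no-turn (inj₂ (_ , refl)) (inj₁ (_ , refl)) = u≢w′ refl
      no-turn (inj₂ (_ , refl)) (inj₂ (_ , refl)) = u≢w refl
      e≢f : e ≢ f
      e≢f refl = no-turn j jf

    rising : ∀ {u v} → TemporalPath G l u v → Rising L 0 u v
    rising (stop , _) = stop
    rising (step e j _ p , u∉ ∷ un) = rise e j (positive e) (rising-after e j p u∉ un)

    sorted-complete : TemporallyConnected G l → Complete (map proj₂ L)
    sorted-complete tc x y = rising⇒⇝ (sort-sorted (labelled G l)) (rising (tc x y))

-- A realization in which the order of the list takes the place of the labels.
Scheme : ∀ {n} → Seq n → Set
Scheme {n} d = ∃[ cs ] (All NoLoop cs × Complete cs × (∀ v → deg {n} cs v ≡ d v))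

TCRealizable⇒Scheme : ∀ {n} {d : Seq n} → TCRealizable d → Scheme d
TCRealizable⇒Scheme {n} {d} (G , (loopless , degrees) , l , positive , proper , tc) =
  cs , All-resp-↭ (↭-sym perm) (Loopless⇒NoLoop G loopless) , sorted-complete G l positive proper tc ,
  λ v → trans (deg-↭ perm v) (degrees v)
  where
  cs = map proj₂ (sort (labelled G l))
  perm : cs ↭ G
  perm = subst (cs ↭_) (labelled-calls G l) (map⁺ proj₂ (sort-↭ (labelled G l)))

-- From lists of calls to proper labelings

module _ {n : ℕ} where

  module _ {G : Multigraph n} {l : Labeling G} where

    weaken : ∀ {s t u v} → s ≤ t → (p : TWalk G l t u v) → Σ[ q ∈ TWalk G l s u v ] verts q ≡ verts p
    weaken s≤t stop = stop , refl
    weaken s≤t (step e j t≤ p) = step e j (≤-trans s≤t t≤) p , refl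

    cut : ∀ {t u v x} (p : TWalk G l t u v) → Unique (verts p) → x ∈ verts p →
          Σ[ q ∈ TWalk G l t x v ] Unique (verts q)
    cut stop un (here refl) = stop , un
    cut p@(step _ _ _ _) un (here refl) = p , un
    cut (step e j t≤ p) (_ ∷ un) (there m) with q , un′ ← cut p un m with q′ , eq ← weaken t≤ q =
      q′ , subst Unique (sym eq) un′

    -- If the starting vertex recurs on the rest of the walk, the walk is started at the recurrence
    -- instead: labels from there on still respect the earlier bound `t`.
    erase-loops : ∀ {t u v} → TWalk G l t u v → Σ[ q ∈ TWalk G l t u v ] Unique (verts q)
    erase-loops stop = stop , [] ∷ []
    erase-loops {u = u} (step e j t≤ p) with q , un ← erase-loops p with Any.any? (u F.≟_) (verts q)
    ... | no u∉ = step e j t≤ q , ¬Any⇒All¬ _ u∉ ∷ un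
    ... | yes u∈ with r , un′ ← cut q un u∈ with r′ , eq ← weaken t≤ r = r′ , subst Unique (sym eq) un′

  TWalk-∷ : ∀ {c} {G : Multigraph n} {l : Labeling (c ∷ G)} {t u v} → TWalk G (l ∘ F.suc) t u v → TWalk (c ∷ G) l t u v
  TWalk-∷ stop = stop
  TWalk-∷ (step e j t≤ p) = step (F.suc e) j t≤ (TWalk-∷ p)

  ⇝⇒TWalk : ∀ (cs : Multigraph n) (l : Labeling cs) {t u v} → (∀ e → t ≤ l e) → (∀ e f → toℕ e ≤ toℕ f → l e ≤ l f) →
            cs ⊢ u ⇝ v → TWalk cs l t u v
  ⇝⇒TWalk cs l t≤ mono here = stop
  ⇝⇒TWalk (c ∷ cs) l t≤ mono (skip p) =
    TWalk-∷ (⇝⇒TWalk cs (l ∘ F.suc) (t≤ ∘ F.suc) (λ e f e≤f → mono _ _ (s≤s e≤f)) p)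
  ⇝⇒TWalk (c ∷ cs) l t≤ mono (fwd p) = step F.zero (inj₁ (refl , refl)) (t≤ F.zero)
    (TWalk-∷ (⇝⇒TWalk cs (l ∘ F.suc) (λ e → mono F.zero (F.suc e) z≤n) (λ e f e≤f → mono _ _ (s≤s e≤f)) p))
  ⇝⇒TWalk (c ∷ cs) l t≤ mono (bwd p) = step F.zero (inj₂ (refl , refl)) (t≤ F.zero)
    (TWalk-∷ (⇝⇒TWalk cs (l ∘ F.suc) (λ e → mono F.zero (F.suc e) z≤n) (λ e f e≤f → mono _ _ (s≤s e≤f)) p))

  NoLoop⇒Loopless : ∀ {G : Multigraph n} → All NoLoop G → Loopless G
  NoLoop⇒Loopless (p ∷ _) F.zero = p
  NoLoop⇒Loopless (_ ∷ ps) (F.suc e) = NoLoop⇒Loopless ps e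

Scheme⇒TCRealizable : ∀ {n} {d : Seq n} → Scheme d → TCRealizable d
Scheme⇒TCRealizable (cs , nl , comp , degrees) =
  -- The labels are list positions, shifted by one to be positive; being pairwise distinct, they are
  -- proper.
  cs , (NoLoop⇒Loopless nl , degrees) , (λ e → suc (toℕ e)) , (λ e → s≤s z≤n) ,
  (λ e f e≢f _ eq → e≢f (toℕ-injective (suc-injective eq))) ,
  λ u v → erase-loops (⇝⇒TWalk cs _ (λ _ → z≤n) (λ _ _ → s≤s) (comp u v))

-- Call lists with prescribed degrees

total-≡0 : ∀ {n} {f : Seq n} → total f ≡ 0 → ∀ x → f x ≡ 0
total-≡0 {f = f} eq x = n≤0⇒n≡0 (≤-trans (term≤total f x) (≤-reflexive eq))

total-∸ : ∀ {n} (f g : Seq n) → (∀ x → g x ≤ f x) → total (λ x → f x ∸ g x) + total g ≡ total f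
total-∸ f g g≤f = trans (sym (total-+ (λ x → f x ∸ g x) g)) (total-cong λ x → m∸n+n≡m (g≤f x))

below-with-total : ∀ {n} (e : Seq n) t → t ≤ total e → ∃[ c ] ((∀ x → c x ≤ e x) × total {n} c ≡ t)
below-with-total {zero} e zero z≤n = e , (λ ()) , refl
below-with-total {suc n} e t t≤
  with c , c≤e , eq ← below-with-total (e ∘ F.suc) (t ∸ e F.zero) (m≤n+o⇒m∸n≤o t (e F.zero) t≤) =
  c′ , c′≤e , trans (cong (e F.zero ⊓ t +_) eq) (m⊓n+n∸m≡n (e F.zero) t)
  where
  c′ : Seq (suc n)
  c′ F.zero = e F.zero ⊓ t
  c′ (F.suc x) = c x
  c′≤e : ∀ x → c′ x ≤ e x
  c′≤e F.zero = m⊓n≤m (e F.zero) t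
  c′≤e (F.suc x) = c≤e x

-- A new vertex with children of its own is preferred. If there is none, all children belong to
-- vertices of `T`, so the forest never runs out of parents.
next-child : ∀ {n} (T : Fin n → Bool) (c : Seq n) → 1 ≤ total (λ x → ⟦ not (T x) ⟧) →
             ∃[ v ] (T v ≡ false × (1 ≤ c v ⊎ (∀ x → T x ≡ false → c x ≡ 0)))
next-child T c #T with any? (λ x → (T x Bool.≟ false) ×-dec (1 ≤? c x))
... | yes (x , Tx , cx) = x , Tx , inj₁ cx
... | no none with v , p ← total-positive (λ x → ⟦ not (T x) ⟧) #T =
  v , false-if (T v) p , inj₂ λ x Tx → n<1⇒n≡0 (≰⇒> λ cx → none (x , Tx , cx))
  where
  false-if : ∀ b → 1 ≤ ⟦ not b ⟧ → b ≡ false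
  false-if false _ = refl

-- A forest of calls spreading from the vertices in T, where c prescribes the number of children.
broadcast : ∀ {n} N (T : Fin n → Bool) (c : Seq n) →
  total (λ x → ⟦ not (T x) ⟧) ≡ N → total c ≡ N → N ≡ 0 ⊎ ∃[ u ] (T u ≡ true × 1 ≤ c u) →
  ∃[ cs ] (All NoLoop cs × (∀ v → deg cs v ≡ c v + ⟦ not (T v) ⟧) × (∀ v → ∃[ r ] (T r ≡ true × cs ⊢ r ⇝ v)))
broadcast zero T c #T #c _ =
  [] , [] , (λ v → sym (cong₂ _+_ (total-≡0 #c v) (total-≡0 #T v))) ,
  λ v → v , not-0 (T v) (total-≡0 #T v) , here
  where
  not-0 : ∀ b → ⟦ not b ⟧ ≡ 0 → b ≡ true
  not-0 true _ = refl
broadcast {n} (suc N) T c #T #c (inj₂ (u , Tu , cu)) =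
  extend (next-child T c (≤-trans (s≤s z≤n) (≤-reflexive (sym #T))))
  where
  Child : Fin n → Set
  Child v = T v ≡ false × (1 ≤ c v ⊎ (∀ x → T x ≡ false → c x ≡ 0))
  extend : ∃ Child →
    ∃[ cs ] (All NoLoop cs × (∀ v → deg cs v ≡ c v + ⟦ not (T v) ⟧) × (∀ v → ∃[ r ] (T r ≡ true × cs ⊢ r ⇝ v)))
  extend (v , Tv , best) = add-call (broadcast N T′ c′ #T′ #c′ (next best))
    where
    T′ : Fin n → Bool
    T′ x = T x ∨ (v == x)
    c′ : Seq n
    c′ x = c x ∸ ind u x
    u≢v : u ≢ v
    u≢v refl with () ← trans (sym Tu) Tv
    ind≤c : ∀ x → ind u x ≤ c x
    ind≤c x with u F.≟ x
    ... | yes refl = cu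
    ... | no _ = z≤n
    T′+v : ∀ x → ⟦ not (T′ x) ⟧ + ind v x ≡ ⟦ not (T x) ⟧
    T′+v x with v F.≟ x
    ... | no _ with T x
    ...   | true = refl
    ...   | false = refl
    T′+v x | yes refl rewrite Tv = refl
    #T′ : total (λ x → ⟦ not (T′ x) ⟧) ≡ N
    #T′ = suc-injective (trans (+-comm 1 _) (trans (cong (total (λ x → ⟦ not (T′ x) ⟧) +_) (sym (total-ind v)))
      (trans (sym (total-+ (λ x → ⟦ not (T′ x) ⟧) (ind v))) (trans (total-cong T′+v) #T))))
    #c′ : total c′ ≡ N
    #c′ = suc-injective (trans (+-comm 1 _) (trans (cong (total c′ +_) (sym (total-ind u))) (trans (total-∸ c (ind u) ind≤c) #c)))
    -- Some vertex of the enlarged set still has a child to place: `v` itself, or, when no vertex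
    -- outside `T` has children, the owner of any remaining child.
    next : 1 ≤ c v ⊎ (∀ x → T x ≡ false → c x ≡ 0) → N ≡ 0 ⊎ ∃[ x ] (T′ x ≡ true × 1 ≤ c′ x)
    next (inj₁ cv) = inj₂ (v , ∨-trueʳ (==-refl v) , subst (λ k → 1 ≤ c v ∸ k) (sym (ind-≢ u≢v)) cv)
    next (inj₂ rest) with 1 ≤? N
    ... | no N≱1 = inj₁ (n<1⇒n≡0 (≰⇒> N≱1))
    ... | yes N≥1 with x , p ← total-positive c′ (≤-trans N≥1 (≤-reflexive (sym #c′))) = inj₂ (x , T′x , p)
      where
      T′x : T′ x ≡ true
      T′x with T x in Tx
      ... | true = refl
      ... | false = contradiction (≤-trans p (≤-trans (m∸n≤m (c x) (ind u x)) (≤-reflexive (rest x Tx)))) λ ()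
    add-call :
      ∃[ cs ] (All NoLoop cs × (∀ v → deg cs v ≡ c′ v + ⟦ not (T′ v) ⟧) × (∀ v → ∃[ r ] (T′ r ≡ true × cs ⊢ r ⇝ v))) →
      ∃[ cs ] (All NoLoop cs × (∀ v → deg cs v ≡ c v + ⟦ not (T v) ⟧) × (∀ v → ∃[ r ] (T r ≡ true × cs ⊢ r ⇝ v)))
    add-call (cs , nl , dg , reach) = (u , v) ∷ cs , u≢v ∷ nl , dg′ , reach′
      where
      dg′ : ∀ w → ind u w + ind v w + deg cs w ≡ c w + ⟦ not (T w) ⟧
      dg′ w = begin
        ind u w + ind v w + deg cs w                      ≡⟨ cong (ind u w + ind v w +_) (dg w) ⟩
        ind u w + ind v w + (c′ w + ⟦ not (T′ w) ⟧)       ≡⟨ lemma (ind u w) (ind v w) (c′ w) ⟦ not (T′ w) ⟧ ⟩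
        (c′ w + ind u w) + (⟦ not (T′ w) ⟧ + ind v w)     ≡⟨ cong₂ _+_ (m∸n+n≡m (ind≤c w)) (T′+v w) ⟩
        c w + ⟦ not (T w) ⟧                               ∎
        where
        open ≡-Reasoning
        lemma : ∀ a b p q → a + b + (p + q) ≡ p + a + (q + b)
        lemma = solve-∀
      reach′ : ∀ w → ∃[ r ] (T r ≡ true × ((u , v) ∷ cs) ⊢ r ⇝ w)
      reach′ w with r , T′r , p ← reach w with ∨-elim (T r) T′r
      ... | inj₁ Tr = r , Tr , skip p
      -- A walk from the new vertex `v` is prolonged backwards to `u` by the call.
      ... | inj₂ v≡r with refl ← ==⇒≡ v r v≡r = u , Tu , fwd p

gather-broadcast : ∀ {n} (T : Fin n → Bool) (C : Multigraph n) {d c c′ : Seq n} →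
  All NoLoop C → (∀ r s → T r ≡ true → T s ≡ true → C ⊢ r ⇝ s) →
  let N = total (λ x → ⟦ not (T x) ⟧) in
  total c ≡ N → N ≡ 0 ⊎ ∃[ u ] (T u ≡ true × 1 ≤ c u) →
  total c′ ≡ N → N ≡ 0 ⊎ ∃[ u ] (T u ≡ true × 1 ≤ c′ u) →
  (∀ v → deg C v + 2 * ⟦ not (T v) ⟧ + (c v + c′ v) ≡ d v) → Scheme d
gather-broadcast T C {d} {c} {c′} nl links #c seed #c′ seed′ degrees
  with F , nlF , dgF , reachF ← broadcast _ T c refl #c seed
     | F′ , nlF′ , dgF′ , reachF′ ← broadcast _ T c′ refl #c′ seed′ =
  -- `F` spreads from the roots, so reversed in time it gathers towards them.
  F ʳ++ (C ++ F′) , NoLoop-ʳ++ nlF (NoLoop-++ nl nlF′) , complete , degrees′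
  where
  complete : Complete (F ʳ++ (C ++ F′))
  complete x y with r , Tr , p ← reachF x | s , Ts , q ← reachF′ y = ⇝-ʳ++ p (⇝-++ (links r s Tr Ts) q)
  degrees′ : ∀ v → deg (F ʳ++ (C ++ F′)) v ≡ d v
  degrees′ v = begin
    deg (F ʳ++ (C ++ F′)) v            ≡⟨ trans (deg-ʳ++ F (C ++ F′) v) (cong (deg F v +_) (deg-++ C F′ v)) ⟩
    deg F v + (deg C v + deg F′ v)     ≡⟨ cong₂ (λ p q → p + (deg C v + q)) (dgF v) (dgF′ v) ⟩
    c v + t + (deg C v + (c′ v + t))   ≡⟨ lemma (c v) (c′ v) t (deg C v) ⟩
    deg C v + 2 * t + (c v + c′ v)     ≡⟨ degrees v ⟩
    d v                                ∎
    where
    open ≡-Reasoning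
    t = ⟦ not (T v) ⟧
    lemma : ∀ p q t k → p + t + (k + (q + t)) ≡ k + 2 * t + (p + q)
    lemma = solve-∀

-- Every non-root has degree one in each of the two forests, so C needs 2 (length C) and
-- the non-roots 2 N of the total degree; the remaining 2 N are the children, to be
-- distributed over both forests so that each of them has a root with a child.
distribute : ∀ {n} (T : Fin n → Bool) (C : Multigraph n) (d : Seq n) →
  All NoLoop C → (∀ r s → T r ≡ true → T s ≡ true → C ⊢ r ⇝ s) →
  let N = total (λ x → ⟦ not (T x) ⟧) in
  total d ≡ 2 * length C + 4 * N →
  (∀ v → deg C v + 2 * ⟦ not (T v) ⟧ ≤ d v) →
  N ≡ 0 ⊎ ∃[ u ] ∃[ u′ ] (T u ≡ true × T u′ ≡ true ×
                          (∀ v → deg C v + 2 * ⟦ not (T v) ⟧ + (ind u v + ind u′ v) ≤ d v)) →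
  Scheme d
distribute {n} T C d nl links #d base≤d seeds = go seeds
  where
  N = total (λ x → ⟦ not (T x) ⟧)
  base e : Seq n
  base v = deg C v + 2 * ⟦ not (T v) ⟧
  e v = d v ∸ base v
  #base : total base ≡ 2 * length C + 2 * N
  #base = trans (total-+ (deg C) (λ v → 2 * ⟦ not (T v) ⟧)) (cong₂ _+_ (total-deg C) (total-*ˡ 2 (λ v → ⟦ not (T v) ⟧)))
  #e : total e ≡ 2 * N
  #e = +-cancelʳ-≡ (2 * length C + 2 * N) (total e) (2 * N) (begin
    total e + (2 * length C + 2 * N)  ≡⟨ cong (total e +_) #base ⟨
    total e + total base              ≡⟨ total-∸ d base base≤d ⟩
    total d                           ≡⟨ #d ⟩
    2 * length C + 4 * N              ≡⟨ lemma (length C) N ⟩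
    2 * N + (2 * length C + 2 * N)    ∎)
    where
    open ≡-Reasoning
    lemma : ∀ l N → 2 * l + 4 * N ≡ 2 * N + (2 * l + 2 * N)
    lemma = solve-∀
  go : N ≡ 0 ⊎ ∃[ u ] ∃[ u′ ] (T u ≡ true × T u′ ≡ true × (∀ v → base v + (ind u v + ind u′ v) ≤ d v)) → Scheme d
  go (inj₁ N≡0) = gather-broadcast T C nl links none (inj₁ N≡0) none (inj₁ N≡0) degrees
    where
    none : total {n} (λ _ → 0) ≡ N
    none = trans (total-const n 0) (trans (*-zeroʳ n) (sym N≡0))
    degrees : ∀ v → base v + 0 ≡ d v
    degrees v = trans (cong (base v +_) (sym (total-≡0 (trans #e (cong (2 *_) N≡0)) v))) (m+[n∸m]≡n (base≤d v))
  go (inj₂ (u , u′ , Tu , Tu′ , seeds≤d)) with 1 ≤? N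
  ... | no N≱1 = go (inj₁ (n<1⇒n≡0 (≰⇒> N≱1)))
  -- One child in each forest is reserved for the seeds `u` and `u′`; of the other 2(N - 1) children
  -- the first forest receives N - 1 and the second the rest.
  ... | yes N≥1 = split (below-with-total e′ (N ∸ 1) (≤-by (N ∸ 1) (≤-reflexive #e′) (lemma (N ∸ 1) (total e′))))
    where
    pair : Seq n
    pair v = ind u v + ind u′ v
    e′ : Seq n
    e′ v = e v ∸ pair v
    pair≤e : ∀ v → pair v ≤ e v
    pair≤e v = m+n≤o⇒m≤o∸n (pair v) (≤-trans (≤-reflexive (+-comm (pair v) (base v))) (seeds≤d v))
    N∸1 : N ∸ 1 + 1 ≡ N
    N∸1 = m∸n+n≡m N≥1
    #pair : total pair ≡ 2
    #pair = trans (total-+ (ind u) (ind u′)) (cong₂ _+_ (total-ind u) (total-ind u′))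
    #e′ : 2 * (N ∸ 1) ≡ total e′
    #e′ = +-cancelʳ-≡ 2 _ _ (begin
      2 * (N ∸ 1) + 2        ≡⟨ *-distribˡ-+ 2 (N ∸ 1) 1 ⟨
      2 * (N ∸ 1 + 1)        ≡⟨ cong (2 *_) N∸1 ⟩
      2 * N                  ≡⟨ #e ⟨
      total e                ≡⟨ total-∸ e pair pair≤e ⟨
      total e′ + total pair  ≡⟨ cong (total e′ +_) #pair ⟩
      total e′ + 2           ∎)
      where open ≡-Reasoning
    lemma : ∀ k t → k + t + k ≡ t + 2 * k
    lemma = solve-∀
    split : ∃[ c ] ((∀ x → c x ≤ e′ x) × total {n} c ≡ N ∸ 1) → Scheme d
    split (c , c≤e′ , #c) =
      gather-broadcast T C nl links
        (plus-one c u #c) (inj₂ (u , Tu , seeded c u))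
        (plus-one (λ v → e′ v ∸ c v) u′ #rest) (inj₂ (u′ , Tu′ , seeded (λ v → e′ v ∸ c v) u′)) degrees
      where
      plus-one : ∀ f w → total f ≡ N ∸ 1 → total (λ v → f v + ind w v) ≡ N
      plus-one f w #f = trans (total-+ f (ind w)) (trans (cong₂ _+_ #f (total-ind w)) N∸1)
      seeded : ∀ (f : Seq n) w → 1 ≤ f w + ind w w
      seeded f w = ≤-trans (≤-reflexive (sym (ind-refl w))) (m≤n+m _ (f w))
      #rest : total (λ v → e′ v ∸ c v) ≡ N ∸ 1
      #rest = +-cancelʳ-≡ (N ∸ 1) _ _ (trans (cong (total (λ v → e′ v ∸ c v) +_) (sym #c))
        (trans (total-∸ e′ c c≤e′) (trans (sym #e′) (cong (N ∸ 1 +_) (+-identityʳ (N ∸ 1))))))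
      degrees : ∀ v → base v + (c v + ind u v + (e′ v ∸ c v + ind u′ v)) ≡ d v
      degrees v = begin
        base v + (c v + ind u v + (e′ v ∸ c v + ind u′ v))  ≡⟨ cong (base v +_) (shuffle (c v) (ind u v) (e′ v ∸ c v) (ind u′ v)) ⟩
        base v + (e′ v ∸ c v + c v + pair v)                ≡⟨ cong (λ k → base v + (k + pair v)) (m∸n+n≡m (c≤e′ v)) ⟩
        base v + (e′ v + pair v)                            ≡⟨ cong (base v +_) (m∸n+n≡m (pair≤e v)) ⟩
        base v + e v                                        ≡⟨ m+[n∸m]≡n (base≤d v) ⟩
        d v                                                 ∎
        where
        open ≡-Reasoning
        shuffle : ∀ p q r s → p + q + (r + s) ≡ r + p + (q + s)
        shuffle = solve-∀

-- Schemes with one, two and four roots.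

-- The case m = 2n - 2. A single root has nothing to exchange, so `C` is empty, and starting both
-- forests at `a` takes degree 2.
one-root : ∀ {n} (d : Seq n) (a : Fin n) → (∀ v → 2 ≤ d v) → total d + 4 ≡ 4 * n → Scheme d
one-root {n} d a d≥2 #d = distribute T [] d [] links #d′ (λ v → ≤-trans (m≤m+n _ (ind a v + ind a v)) (base≤d v))
  (inj₂ (a , a , ==-refl a , ==-refl a , base≤d))
  where
  T : Fin n → Bool
  T x = a == x
  N = total (λ x → ⟦ not (T x) ⟧)
  links : ∀ r s → T r ≡ true → T s ≡ true → [] ⊢ r ⇝ s
  links r s Tr Ts with refl ← ==⇒≡ a r Tr | refl ← ==⇒≡ a s Ts = here
  #T : N + 1 ≡ n
  #T = begin
    N + 1                                  ≡⟨ cong (N +_) (total-ind a) ⟨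
    N + total (ind a)                      ≡⟨ total-+ (λ x → ⟦ not (T x) ⟧) (ind a) ⟨
    total (λ x → ⟦ not (T x) ⟧ + ind a x)  ≡⟨ total-cong pointwise ⟩
    total {n} (λ _ → 1)                    ≡⟨ trans (total-const n 1) (*-identityʳ n) ⟩
    n                                      ∎
    where
    open ≡-Reasoning
    pointwise : ∀ x → ⟦ not (T x) ⟧ + ind a x ≡ 1
    pointwise x with a F.≟ x
    ... | yes _ = refl
    ... | no _ = refl
  #d′ : total d ≡ 4 * N
  #d′ = +-cancelʳ-≡ 4 _ _ (trans #d (trans (cong (4 *_) (sym #T)) (*-distribˡ-+ 4 N 1)))
  base≤d : ∀ v → 2 * ⟦ not (T v) ⟧ + (ind a v + ind a v) ≤ d v
  base≤d v with a F.≟ v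
  ... | yes _ = d≥2 v
  ... | no _ = d≥2 v

-- The case m = 2n - 3, where `q` may have degree one. After the call between the roots each of them
-- starts one forest, or `p` starts both when `q` has degree one.
two-roots : ∀ {n} (d : Seq n) {p q : Fin n} → p ≢ q → 1 ≤ d q → (∀ v → v ≢ q → 2 ≤ d v) → 4 ≤ d p + d q →
            total d + 6 ≡ 4 * n → Scheme d
two-roots {n} d {p} {q} p≢q dq d≥2 dpq #d =
  distribute T C d (p≢q ∷ []) links #d′ base≤d (inj₂ seeds)
  where
  C : Multigraph n
  C = (p , q) ∷ []
  T : Fin n → Bool
  T = hit (p , q)
  N = total (λ x → ⟦ not (T x) ⟧)
  links : ∀ r s → T r ≡ true → T s ≡ true → C ⊢ r ⇝ s
  links r s Tr Ts with hit-elim p q r Tr | hit-elim p q s Ts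
  ... | inj₁ refl | inj₁ refl = skip here
  ... | inj₁ refl | inj₂ refl = fwd here
  ... | inj₂ refl | inj₁ refl = bwd here
  ... | inj₂ refl | inj₂ refl = skip here
  #T : N + 2 ≡ n
  #T = begin
    N + 2                                             ≡⟨ cong (N +_) (trans (total-+ (ind p) (ind q)) (cong₂ _+_ (total-ind p) (total-ind q))) ⟨
    N + total (λ x → ind p x + ind q x)               ≡⟨ total-+ (λ x → ⟦ not (T x) ⟧) (λ x → ind p x + ind q x) ⟨
    total (λ x → ⟦ not (T x) ⟧ + (ind p x + ind q x)) ≡⟨ total-cong pointwise ⟩
    total {n} (λ _ → 1)                               ≡⟨ trans (total-const n 1) (*-identityʳ n) ⟩
    n                                                 ∎
    where
    open ≡-Reasoning
    pointwise : ∀ x → ⟦ not (T x) ⟧ + (ind p x + ind q x) ≡ 1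
    pointwise x rewrite ind-call≡hit p≢q x with T x
    ... | true = refl
    ... | false = refl
  #d′ : total d ≡ 2 + 4 * N
  #d′ = +-cancelʳ-≡ 6 _ _ (trans #d (trans (cong (4 *_) (sym #T)) (lemma N)))
    where
    lemma : ∀ N → 4 * (N + 2) ≡ 2 + 4 * N + 6
    lemma = solve-∀
  extra : ∀ (f : Seq n) → 1 + f p ≤ d p → 1 + f q ≤ d q → (∀ v → p ≢ v → q ≢ v → f v ≡ 0) →
          ∀ v → deg C v + 2 * ⟦ not (T v) ⟧ + f v ≤ d v
  extra f fp fq f0 v with p F.≟ v | q F.≟ v
  ... | yes refl | yes refl = contradiction refl p≢q
  ... | yes refl | no _ = fp
  ... | no _ | yes refl = fq
  ... | no p≢v | no q≢v rewrite f0 v p≢v q≢v = d≥2 v (q≢v ∘ sym)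
  base≤d : ∀ v → deg C v + 2 * ⟦ not (T v) ⟧ ≤ d v
  base≤d v = ≤-trans (m≤m+n _ 0) (extra (λ _ → 0) (≤-trans (s≤s z≤n) (d≥2 p p≢q)) dq (λ _ _ _ → refl) v)
  seeds : ∃[ u ] ∃[ u′ ] (T u ≡ true × T u′ ≡ true ×
                          (∀ v → deg C v + 2 * ⟦ not (T v) ⟧ + (ind u v + ind u′ v) ≤ d v))
  seeds with 2 ≤? d q
  ... | yes dq≥2 = p , q , hit₁ p q , hit₂ p q , extra (λ v → ind p v + ind q v)
    (≤-trans (s≤s (ind-call≤1 p≢q p)) (d≥2 p p≢q)) (≤-trans (s≤s (ind-call≤1 p≢q q)) dq≥2)
    (λ v p≢v q≢v → cong₂ _+_ (ind-≢ p≢v) (ind-≢ q≢v))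
  ... | no dq≱2 = p , p , hit₁ p q , hit₁ p q , extra (λ v → ind p v + ind p v)
    (≤-trans (≤-reflexive (cong (λ k → 1 + (k + k)) (ind-refl p))) dp≥3)
    (≤-trans (≤-reflexive (cong (λ k → 1 + (k + k)) (ind-≢ p≢q))) dq)
    (λ v p≢v _ → cong (λ k → k + k) (ind-≢ p≢v))
    where
    dp≥3 : 3 ≤ d p
    dp≥3 = +-cancelʳ-≤ 1 3 (d p) (≤-trans dpq (+-monoʳ-≤ (d p) (s≤s⁻¹ (≰⇒> dq≱2))))

-- The extremal case m = 2n - 4. Four calls around a cycle exchange everything among four vertices
-- of largest degree and use degree 2 at each.
four-roots : ∀ k (d : Seq (4 + k)) → NonIncreasing d → (∀ v → 2 ≤ d v) → total d + 8 ≡ 4 * (4 + k) → Scheme d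
four-roots k d mono d≥2 #d = distribute T C d ((λ ()) ∷ (λ ()) ∷ (λ ()) ∷ (λ ()) ∷ []) links #d′ base≤d seeds
  where
  pattern 0F = F.zero
  pattern 1F = F.suc F.zero
  pattern 2F = F.suc (F.suc F.zero)
  pattern 3F = F.suc (F.suc (F.suc F.zero))
  pattern 4+ i = F.suc (F.suc (F.suc (F.suc i)))
  C : Multigraph (4 + k)
  C = (0F , 1F) ∷ (2F , 3F) ∷ (0F , 2F) ∷ (1F , 3F) ∷ []
  T : Fin (4 + k) → Bool
  T (4+ _) = false
  T _ = true
  links : ∀ r s → T r ≡ true → T s ≡ true → C ⊢ r ⇝ s
  links 0F 0F _ _ = skip (skip (skip (skip here)))
  links 0F 1F _ _ = fwd (skip (skip (skip here)))
  links 0F 2F _ _ = skip (skip (fwd (skip here)))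
  links 0F 3F _ _ = fwd (skip (skip (fwd here)))
  links 1F 0F _ _ = bwd (skip (skip (skip here)))
  links 1F 1F _ _ = skip (skip (skip (skip here)))
  links 1F 2F _ _ = bwd (skip (fwd (skip here)))
  links 1F 3F _ _ = skip (skip (skip (fwd here)))
  links 2F 0F _ _ = skip (skip (bwd (skip here)))
  links 2F 1F _ _ = skip (fwd (skip (bwd here)))
  links 2F 2F _ _ = skip (skip (skip (skip here)))
  links 2F 3F _ _ = skip (fwd (skip (skip here)))
  links 3F 0F _ _ = skip (bwd (bwd (skip here)))
  links 3F 1F _ _ = skip (skip (skip (bwd here)))
  links 3F 2F _ _ = skip (bwd (skip (skip here)))
  links 3F 3F _ _ = skip (skip (skip (skip here)))
  N = total (λ x → ⟦ not (T x) ⟧)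
  #T : N ≡ k
  #T = trans (total-const k 1) (*-identityʳ k)
  #d′ : total d ≡ 8 + 4 * N
  #d′ = +-cancelʳ-≡ 8 _ _ (trans #d (trans (cong (λ j → 4 * (4 + j)) (sym #T)) (lemma N)))
    where
    lemma : ∀ N → 4 * (4 + N) ≡ 8 + 4 * N + 8
    lemma = solve-∀
  base≤d : ∀ v → deg C v + 2 * ⟦ not (T v) ⟧ ≤ d v
  base≤d 0F = d≥2 0F
  base≤d 1F = d≥2 1F
  base≤d 2F = d≥2 2F
  base≤d 3F = d≥2 3F
  base≤d (4+ i) = d≥2 (4+ i)
  seeds : N ≡ 0 ⊎ ∃[ u ] ∃[ u′ ] (T u ≡ true × T u′ ≡ true ×
                          (∀ v → deg C v + 2 * ⟦ not (T v) ⟧ + (ind u v + ind u′ v) ≤ d v))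
  seeds with 1 ≤? k | 4 ≤? d 0F | 3 ≤? d 1F
  ... | no k≱1 | _ | _ = inj₁ (trans #T (n<1⇒n≡0 (≰⇒> k≱1)))
  ... | yes _ | yes d0≥4 | _ = inj₂ (0F , 0F , refl , refl , λ where
    0F → d0≥4
    1F → d≥2 1F
    2F → d≥2 2F
    3F → d≥2 3F
    (4+ i) → d≥2 (4+ i))
  ... | yes _ | no _ | yes d1≥3 = inj₂ (0F , 1F , refl , refl , λ where
    0F → ≤-trans d1≥3 (mono 0F 1F z≤n)
    1F → d1≥3
    2F → d≥2 2F
    3F → d≥2 3F
    (4+ i) → d≥2 (4+ i))
  -- Here the total is at most 3 + 2(k + 3), but it equals 4k + 8, which is impossible for positive
  -- `k`.
  ... | yes k≥1 | no d0≱4 | no d1≱3 = ⊥-elim (absurd-by 0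
      (+-mono-≤ (+-mono-≤ (≤-reflexive (sym #d)) (+-mono-≤ d0≤3 rest≤)) (*-monoʳ-≤ 2 k≥1))
      (lemma k (d 0F) (total (d ∘ F.suc))))
    where
    d0≤3 : d 0F ≤ 3
    d0≤3 = s≤s⁻¹ (≰⇒> d0≱4)
    rest≤ : total (d ∘ F.suc) ≤ (3 + k) * 2
    rest≤ = ≤-trans (total-mono λ x → ≤-trans (mono 1F (F.suc x) (s≤s z≤n)) (s≤s⁻¹ (≰⇒> d1≱3)))
                    (≤-reflexive (total-const (3 + k) 2))
    lemma : ∀ k p r → p + r + 8 + (3 + (3 + k) * 2) + 2 * k + 1 ≡ 4 * (4 + k) + (p + r) + 2
    lemma = solve-∀

-- Sequences with surplus degree.

argmax : ∀ {n} (d : Seq (suc n)) → ∃[ a ] (∀ v → d v ≤ d a)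
argmax {zero} d = F.zero , λ { F.zero → ≤-refl }
argmax {suc n} d with a , d≤ ← argmax (d ∘ F.suc) with d F.zero ≤? d (F.suc a)
... | yes 0≤a = F.suc a , λ { F.zero → 0≤a ; (F.suc v) → d≤ v }
... | no 0≰a = F.zero , λ { F.zero → ≤-refl ; (F.suc v) → ≤-trans (d≤ v) (<⇒≤ (≰⇒> 0≰a)) }

another : ∀ {n} → 2 ≤ n → (q : Fin n) → ∃[ p ] p ≢ q
another (s≤s (s≤s _)) F.zero = F.suc F.zero , λ ()
another (s≤s (s≤s _)) (F.suc q) = F.zero , λ ()

three≤total : ∀ {n} (d : Seq n) {a b v} → a ≢ b → v ≢ a → v ≢ b → d a + d b + d v ≤ total d
three≤total d {a} {b} {v} a≢b v≢a v≢b = begin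
  d a + d b + d v
    ≡⟨ cong₂ _+_ (cong₂ _+_ (total-ind-* a d) (total-ind-* b d)) (total-ind-* v d) ⟨
  total (λ x → ind a x * d x) + total (λ x → ind b x * d x) + total (λ x → ind v x * d x)
    ≡⟨ cong (_+ total (λ x → ind v x * d x)) (total-+ (λ x → ind a x * d x) (λ x → ind b x * d x)) ⟨
  total (λ x → ind a x * d x + ind b x * d x) + total (λ x → ind v x * d x)
    ≡⟨ total-+ (λ x → ind a x * d x + ind b x * d x) (λ x → ind v x * d x) ⟨
  total (λ x → ind a x * d x + ind b x * d x + ind v x * d x)
    ≤⟨ total-mono pointwise ⟩
  total d ∎
  where
  open ≤-Reasoning
  pointwise : ∀ x → ind a x * d x + ind b x * d x + ind v x * d x ≤ d x
  pointwise x with a F.≟ x | b F.≟ x | v F.≟ x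
  ... | yes refl | yes refl | _ = contradiction refl a≢b
  ... | yes refl | no _ | yes refl = contradiction refl v≢a
  ... | no _ | yes refl | yes refl = contradiction refl v≢b
  ... | yes refl | no _ | no _ = ≤-reflexive (lemma (d a))
    where
    lemma : ∀ k → 1 * k + 0 + 0 ≡ k
    lemma = solve-∀
  ... | no _ | yes refl | no _ = ≤-reflexive (lemma (d b))
    where
    lemma : ∀ k → 1 * k + 0 ≡ k
    lemma = solve-∀
  ... | no _ | no _ | yes refl = ≤-reflexive (*-identityˡ (d v))
  ... | no _ | no _ | no _ = z≤n

-- Extra degree is consumed by calls between a vertex of maximal degree and another one of
-- degree at least 3; if there is none of the latter, d is the sequence of a doubled star.
abundant : ∀ k {n} (d : Seq n) (q : Fin n) → 3 ≤ n → 1 ≤ d q → (∀ v → v ≢ q → 2 ≤ d v) →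
           (∀ v → 2 * d v ≤ total d) → total d + 6 ≡ 4 * n + 2 * k → Scheme d
abundant zero {n} d q n≥3 dq d≥2 bal #d with any? (λ p → ¬? (p F.≟ q) ×-dec (4 ≤? d p + d q))
... | yes (p , p≢q , dpq) = two-roots d p≢q dq d≥2 dpq (trans #d (+-identityʳ _))
-- Without a suitable partner all degrees are at most 2 and that of `q` at most 1, so the total 4n -
-- 6 would be below 2n, against n ≥ 3.
... | no none = ⊥-elim (absurd-by 0
    (+-mono-≤ (+-mono-≤ total≤ (≤-reflexive (sym #d))) (*-monoʳ-≤ 2 n≥3)) (lemma n (total d)))
  where
  small : ∀ p → p ≢ q → d p + d q ≤ 3
  small p p≢q = s≤s⁻¹ (≰⇒> λ dpq → none (p , p≢q , dpq))
  pointwise : ∀ x → d x + ind q x ≤ 2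
  pointwise x with q F.≟ x
  ... | no q≢x = ≤-by 0 (+-mono-≤ (small x (q≢x ∘ sym)) dq) (lemma′ (d x) (d q))
    where
    lemma′ : ∀ p q → p + 0 + (3 + q) + 0 ≡ 2 + (p + q + 1)
    lemma′ = solve-∀
  ... | yes refl with p , p≢q ← another (≤-trans (s≤s (s≤s z≤n)) n≥3) q =
    ≤-by 0 (+-mono-≤ (small p p≢q) (d≥2 p p≢q)) (lemma′ (d p) (d q))
    where
    lemma′ : ∀ p q → q + 1 + (3 + p) + 0 ≡ 2 + (p + q + 2)
    lemma′ = solve-∀
  total≤ : total d + 1 ≤ n * 2
  total≤ = begin
    total d + 1                ≡⟨ cong (total d +_) (total-ind q) ⟨
    total d + total (ind q)    ≡⟨ total-+ d (ind q) ⟨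
    total (λ x → d x + ind q x) ≤⟨ total-mono pointwise ⟩
    total {n} (λ _ → 2)        ≡⟨ total-const n 2 ⟩
    n * 2                      ∎
    where open ≤-Reasoning
  lemma : ∀ n t → n * 2 + (t + 6) + 2 * n + 1 ≡ t + 1 + (4 * n + 2 * 0) + 2 * 3
  lemma = solve-∀
abundant (suc k) {suc n} d q n≥3 dq d≥2 bal #d with a , d≤da ← argmax d
  with any? (λ b → ¬? (b F.≟ a) ×-dec (3 ≤? d b))
... | yes (b , b≢a , db≥3) = add-call (abundant k d′ q n≥3 d′q d′≥2 bal′ #d′)
  where
  a≢b : a ≢ b
  a≢b = b≢a ∘ sym
  pair d′ : Seq (suc n)
  pair x = ind a x + ind b x
  d′ x = d x ∸ pair x
  hit≥3 : ∀ x → hit (a , b) x ≡ true → 3 ≤ d x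
  hit≥3 x h with hit-elim a b x h
  ... | inj₁ refl = ≤-trans db≥3 (d≤da b)
  ... | inj₂ refl = db≥3
  d′-cases : ∀ x → (2 ≤ d′ x × suc (d′ x) ≡ d x) ⊎ (d′ x ≡ d x × x ≢ a × x ≢ b)
  d′-cases x rewrite ind-call≡hit a≢b x with hit (a , b) x in h
  ... | true = inj₁ (∸-monoˡ-≤ 1 (hit≥3 x h) , m+[n∸m]≡n (≤-trans (s≤s z≤n) (hit≥3 x h)))
  ... | false = inj₂ (refl , (λ { refl → true≢false (trans (sym (hit₁ a b)) h) })
                           , (λ { refl → true≢false (trans (sym (hit₂ a b)) h) }))
    where
    true≢false : true ≢ false
    true≢false ()
  pair≤d : ∀ x → pair x ≤ d x
  pair≤d x rewrite ind-call≡hit a≢b x with hit (a , b) x in h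
  ... | true = ≤-trans (s≤s z≤n) (hit≥3 x h)
  ... | false = z≤n
  total-d′ : total d′ + 2 ≡ total d
  total-d′ = trans (cong (total d′ +_) (sym (trans (total-+ (ind a) (ind b)) (cong₂ _+_ (total-ind a) (total-ind b)))))
                   (total-∸ d pair pair≤d)
  #d′ : total d′ + 6 ≡ 4 * suc n + 2 * k
  #d′ = +-cancelʳ-≡ 2 _ _ (trans (lemma (total d′)) (trans (cong (_+ 6) total-d′) (trans #d (lemma′ n k))))
    where
    lemma : ∀ t → t + 6 + 2 ≡ t + 2 + 6
    lemma = solve-∀
    lemma′ : ∀ n k → 4 * suc n + 2 * suc k ≡ 4 * suc n + 2 * k + 2
    lemma′ = solve-∀
  d′q : 1 ≤ d′ q
  d′q with d′-cases q
  ... | inj₁ (p , _) = ≤-trans (s≤s z≤n) p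
  ... | inj₂ (eq , _) = ≤-trans dq (≤-reflexive (sym eq))
  d′≥2 : ∀ v → v ≢ q → 2 ≤ d′ v
  d′≥2 v v≢q with d′-cases v
  ... | inj₁ (p , _) = p
  ... | inj₂ (eq , _) = ≤-trans (d≥2 v v≢q) (≤-reflexive (sym eq))
  bal′ : ∀ v → 2 * d′ v ≤ total d′
  bal′ v with d′-cases v
  ... | inj₁ (_ , eq) = +-cancelʳ-≤ 2 _ _ (begin
    2 * d′ v + 2    ≡⟨ lemma (d′ v) ⟩
    2 * suc (d′ v)  ≡⟨ cong (2 *_) eq ⟩
    2 * d v         ≤⟨ bal v ⟩
    total d         ≡⟨ total-d′ ⟨
    total d′ + 2    ∎)
    where
    open ≤-Reasoning
    lemma : ∀ k → 2 * k + 2 ≡ 2 * suc k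
    lemma = solve-∀
  -- d v + d a + d b is at most the total; with d v ≤ d a and d b ≥ 3 this leaves room for the two
  -- units removed.
  ... | inj₂ (eq , v≢a , v≢b) rewrite eq =
    ≤-by 1 (+-mono-≤ (+-mono-≤ (three≤total d a≢b v≢a v≢b) (≤-reflexive (sym total-d′))) (+-mono-≤ (d≤da v) db≥3))
      (lemma (d v) (d a) (d b) (total d) (total d′))
    where
    lemma : ∀ v a b t t′ → 2 * v + (t + (t′ + 2) + (a + b)) + 1 ≡ t′ + (a + b + v + t + (v + 3))
    lemma = solve-∀
  add-call : Scheme d′ → Scheme d
  add-call (cs , nl , comp , degrees) = (a , b) ∷ cs , a≢b ∷ nl , (λ x y → skip (comp x y)) ,
    λ v → trans (cong (pair v +_) (degrees v)) (m+[n∸m]≡n (pair≤d v))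
... | no none = star
  where
  d≤2 : ∀ v → v ≢ a → d v ≤ 2
  d≤2 v v≢a = s≤s⁻¹ (≰⇒> λ dv≥3 → none (v , v≢a , dv≥3))
  -- All degrees except that of `a` are at most 2, and `f` stands for a shortfall below 2. Combined
  -- with `bal a`, the zero shortfall gives `k ≡ 0`, and the shortfall `ind v` excludes a degree
  -- below 2 at any `v` other than `a`.
  total-bound : ∀ (f : Seq (suc n)) → (∀ x → d x + f x + ind a x * 2 ≤ 2 + ind a x * d a) →
                total d + total f + 2 ≤ suc n * 2 + d a
  total-bound f pointwise = begin
    total d + total f + 2
      ≡⟨ cong₂ _+_ (total-+ d f) (total-ind-* a (λ _ → 2)) ⟨
    total (λ x → d x + f x) + total (λ x → ind a x * 2)
      ≡⟨ total-+ (λ x → d x + f x) (λ x → ind a x * 2) ⟨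
    total (λ x → d x + f x + ind a x * 2)    ≤⟨ total-mono pointwise ⟩
    total (λ x → 2 + ind a x * d a)          ≡⟨ total-+ (λ _ → 2) (λ x → ind a x * d a) ⟩
    total {suc n} (λ _ → 2) + total (λ x → ind a x * d a)
      ≡⟨ cong₂ _+_ (total-const (suc n) 2) (total-ind-* a (λ _ → d a)) ⟩
    suc n * 2 + d a                          ∎
    where open ≤-Reasoning
  at-a : ∀ k → k + 0 + 2 ≤ 2 + (k + 0)
  at-a k = ≤-reflexive (+-comm (k + 0) 2)
  k≡0 : k ≡ 0
  k≡0 = n≤0⇒n≡0 (*-cancelˡ-≤ 2 (≤-by 0
      (+-mono-≤ (*-monoʳ-≤ 2 (total-bound (λ _ → 0) pointwise)) (+-mono-≤ (bal a) (≤-reflexive (sym #d))))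
      (trans (lemma n k (total d) (d a)) (cong (λ z → 2 * 0 + (2 * (total d + z + 2) + (2 * d a + (4 * suc n + 2 * suc k)))) (sym zero-total)))))
    where
    pointwise : ∀ x → d x + 0 + ind a x * 2 ≤ 2 + ind a x * d a
    pointwise x with a F.≟ x
    ... | yes refl = at-a (d a)
    ... | no a≢x = ≤-trans (≤-reflexive (trans (+-identityʳ _) (+-identityʳ _))) (≤-trans (d≤2 x (a≢x ∘ sym)) (m≤m+n 2 0))
    zero-total : total {suc n} (λ _ → 0) ≡ 0
    zero-total = trans (total-const (suc n) 0) (*-zeroʳ (suc n))
    lemma : ∀ n k t a → 2 * k + (2 * (suc n * 2 + a) + (t + (t + 6))) + 0
                      ≡ 2 * 0 + (2 * (t + 0 + 2) + (2 * a + (4 * suc n + 2 * suc k)))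
    lemma = solve-∀
  d≥2′ : ∀ v → 2 ≤ d v
  d≥2′ v with 2 ≤? d v | v F.≟ a
  ... | yes p | _ = p
  ... | no dv≱2 | yes refl with p , p≢q ← another (≤-trans (s≤s (s≤s z≤n)) n≥3) q = ≤-trans (d≥2 p p≢q) (d≤da p)
  ... | no dv≱2 | no v≢a = ⊥-elim (absurd-by (2 * k + 1)
      (+-mono-≤ (*-monoʳ-≤ 2 (total-bound (ind v) pointwise)) (+-mono-≤ (bal a) (≤-reflexive (sym #d))))
      (trans (lemma n k (total d) (d a)) (cong (λ z → 2 * (total d + z + 2) + (2 * d a + (4 * suc n + 2 * suc k))) (sym (total-ind v)))))
    where
    pointwise : ∀ x → d x + ind v x + ind a x * 2 ≤ 2 + ind a x * d a
    pointwise x with a F.≟ x | v F.≟ x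
    ... | yes refl | yes refl = contradiction refl v≢a
    ... | yes refl | no _ = at-a (d a)
    ... | no _ | yes refl = ≤-trans (≤-reflexive (trans (+-identityʳ _) (+-comm (d v) 1))) (≰⇒> dv≱2)
    ... | no a≢x | no _ = ≤-trans (≤-reflexive (trans (+-identityʳ _) (+-identityʳ _))) (≤-trans (d≤2 x (a≢x ∘ sym)) (m≤m+n 2 0))
    lemma : ∀ n k t a → 2 * (suc n * 2 + a) + (t + (t + 6)) + suc (2 * k + 1)
                      ≡ 2 * (t + 1 + 2) + (2 * a + (4 * suc n + 2 * suc k))
    lemma = solve-∀
  star : Scheme d
  star = one-root d a d≥2′ (+-cancelʳ-≡ 2 _ _ (trans (+-assoc (total d) 4 2)
    (trans #d (cong (λ j → 4 * suc n + 2 * suc j) k≡0))))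

-- The two directions of the characterization.

-- In terms of m the alternatives are m = 2n - 4 and m ≥ 2n - 3; adding 8 and 6 to the degree sum
-- avoids truncated subtraction.
Conditions : ∀ n → Seq n → Set
Conditions n d = (total d + 8 ≡ 4 * n × AtLeastAt d n 2)
  ⊎ (4 * n ≤ total d + 6 × (n ≤ 2 ⊎ (2 < n × AtLeastAt d (n ∸ 1) 2 × AtLeastAt d n 1)))

total≡2length : ∀ {n} {d : Seq n} cs → (∀ v → deg cs v ≡ d v) → total d ≡ 2 * length cs
total≡2length cs degrees = trans (total-cong (sym ∘ degrees)) (total-deg cs)

module _ {n : ℕ} {d : Seq n} (mono : NonIncreasing d) where

  necessary-large : 2 < n → Scheme d → Conditions n d
  necessary-large n>2 (cs , nl , comp , degrees) with 4 * n ≤? total d + 6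
  ... | yes enough = inj₂ (enough , inj₂ (n>2 , second , first))
    where
    first : AtLeastAt d n 1
    first i _ with p , p≢i ← another (<⇒≤ n>2) i =
      ≤-trans (occ⇒deg nl (reached-occ {cs = cs} (p≢i ∘ sym) (comp p i))) (≤-reflexive (degrees i))
    second : AtLeastAt d (n ∸ 1) 2
    second i i≡ with 2 ≤? d i
    ... | yes di = di
    -- By monotonicity the next vertex `j` also has degree at most one, and as n > 2 the first
    -- vertex `z` differs from both.
    ... | no di≱2 = ⊥-elim (two-leaves {z = z} nl (≤-trans (≤-reflexive (degrees i)) di≤1)
        (≤-trans (≤-reflexive (degrees j)) (≤-trans (mono i j (≤-trans (n≤1+n _) (≤-reflexive (sym j≡)))) di≤1))
        (λ i≡j → 1+n≢n (trans (sym j≡) (cong toℕ (sym i≡j))))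
        (λ z≡i → <⇒≢ 0<i (trans (sym z≡0) (cong toℕ z≡i)))
        (λ z≡j → <⇒≢ (≤-trans 0<i (≤-trans (n≤1+n _) (≤-reflexive (sym j≡)))) (trans (sym z≡0) (cong toℕ z≡j)))
        (comp i j) (comp j i) (comp i z))
      where
      di≤1 : d i ≤ 1
      di≤1 = s≤s⁻¹ (≰⇒> di≱2)
      1+i<n : suc (toℕ i) < n
      1+i<n = ≤-reflexive (trans (cong suc i≡) (m+[n∸m]≡n (≤-trans (s≤s z≤n) n>2)))
      j z : Fin n
      j = fromℕ< 1+i<n
      z = fromℕ< (≤-trans (s≤s z≤n) n>2)
      j≡ : toℕ j ≡ suc (toℕ i)
      j≡ = toℕ-fromℕ< 1+i<n
      z≡0 : toℕ z ≡ 0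
      z≡0 = toℕ-fromℕ< (≤-trans (s≤s z≤n) n>2)
      0<i : 0 < toℕ i
      0<i = s≤s⁻¹ (≤-trans (∸-monoˡ-≤ 1 n>2) (≤-reflexive (sym i≡)))
  -- Now m is below 2n - 3, so `length-bound` forces m = 2n - 4, and `leaf-bound` rules out degrees
  -- below 2.
  ... | no few = inj₁ (exact , last)
    where
    m = length cs
    few′ : ¬ (2 * n ≤ 3 + m)
    few′ p = few (≤-trans (≤-trans (≤-reflexive (lemma n)) (*-monoʳ-≤ 2 p))
                          (≤-reflexive (trans (lemma′ m) (cong (_+ 6) (sym (total≡2length cs degrees))))))
      where
      lemma : ∀ n → 4 * n ≡ 2 * (2 * n)
      lemma = solve-∀
      lemma′ : ∀ m → 2 * (3 + m) ≡ 2 * m + 6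
      lemma′ = solve-∀
    exact : total d + 8 ≡ 4 * n
    exact = begin
      total d + 8   ≡⟨ cong (_+ 8) (total≡2length cs degrees) ⟩
      2 * m + 8     ≡⟨ *-distribˡ-+ 2 m 4 ⟨
      2 * (m + 4)   ≡⟨ cong (2 *_) (≤-antisym (≤-trans (≤-reflexive (+-comm m 4)) (≰⇒> few′)) (length-bound n cs nl comp)) ⟩
      2 * (2 * n)   ≡⟨ *-assoc 2 2 n ⟨
      4 * n         ∎
      where open ≡-Reasoning
    last : AtLeastAt d n 2
    last i _ with 2 ≤? d i
    ... | yes di = di
    ... | no di≱2 = contradiction (leaf-bound nl comp (≤-trans (≤-reflexive (degrees i)) (s≤s⁻¹ (≰⇒> di≱2)))) few′

  sufficient-large : 2 < n → Multigraphical d → 4 * n ≤ total d + 6 → AtLeastAt d (n ∸ 1) 2 → AtLeastAt d n 1 → Scheme d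
  sufficient-large n>2 (G , loopless , degrees) enough second first =
    -- The surplus is m - (2n - 3), and the last vertex `q` is the one allowed to have degree one.
    abundant (length G + 3 ∸ 2 * n) d q n>2 (first q 1+q≡n) others balanced #d
    where
    n≥1 : 1 ≤ n
    n≥1 = ≤-trans (s≤s z≤n) n>2
    n∸1<n : n ∸ 1 < n
    n∸1<n = ≤-reflexive (m+[n∸m]≡n n≥1)
    n∸2<n : n ∸ 2 < n
    n∸2<n = ≤-<-trans (∸-monoʳ-≤ n (s≤s z≤n)) n∸1<n
    q r : Fin n
    q = fromℕ< n∸1<n
    r = fromℕ< n∸2<n
    1+q≡n : suc (toℕ q) ≡ n
    1+q≡n = trans (cong suc (toℕ-fromℕ< n∸1<n)) (m+[n∸m]≡n n≥1)
    1+r≡n∸1 : suc (toℕ r) ≡ n ∸ 1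
    1+r≡n∸1 = trans (cong suc (toℕ-fromℕ< n∸2<n)) (suc∸ n n>2)
      where
      suc∸ : ∀ k → 2 < k → suc (k ∸ 2) ≡ k ∸ 1
      suc∸ (suc zero) (s≤s ())
      suc∸ (suc (suc k)) _ = refl
    others : ∀ v → v ≢ q → 2 ≤ d v
    others v v≢q = ≤-trans (second r 1+r≡n∸1) (mono v r (s≤s⁻¹ (≤-trans v<q (≤-reflexive (trans q≡ (sym 1+r≡n∸1))))))
      where
      q≡ : toℕ q ≡ n ∸ 1
      q≡ = toℕ-fromℕ< n∸1<n
      v<q : toℕ v < toℕ q
      v<q = ≤∧≢⇒< (s≤s⁻¹ (≤-trans (toℕ<n v) (≤-reflexive (sym 1+q≡n)))) (v≢q ∘ toℕ-injective)
    -- In a loopless multigraph no degree exceeds the number of edges, which is half of the total.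
    balanced : ∀ v → 2 * d v ≤ total d
    balanced v = begin
      2 * d v        ≡⟨ cong (2 *_) (degrees v) ⟨
      2 * deg G v    ≤⟨ *-monoʳ-≤ 2 (deg≤length (Loopless⇒NoLoop G loopless) v) ⟩
      2 * length G   ≡⟨ total≡2length G degrees ⟨
      total d        ∎
      where open ≤-Reasoning
    lemma : ∀ m → 2 * m + 6 ≡ 2 * (m + 3)
    lemma = solve-∀
    #d : total d + 6 ≡ 4 * n + 2 * (length G + 3 ∸ 2 * n)
    #d = begin
      total d + 6                                ≡⟨ cong (_+ 6) (total≡2length G degrees) ⟩
      2 * length G + 6                           ≡⟨ lemma (length G) ⟩
      2 * (length G + 3)                         ≡⟨ cong (2 *_) (m+[n∸m]≡n 2n≤) ⟨
      2 * (2 * n + (length G + 3 ∸ 2 * n))       ≡⟨ lemma′ n (length G + 3 ∸ 2 * n) ⟩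
      4 * n + 2 * (length G + 3 ∸ 2 * n)         ∎
      where
      open ≡-Reasoning
      lemma′ : ∀ n k → 2 * (2 * n + k) ≡ 4 * n + 2 * k
      lemma′ = solve-∀
      2n≤ : 2 * n ≤ length G + 3
      2n≤ = *-cancelˡ-≤ 2 (≤-trans (≤-reflexive (sym (*-assoc 2 2 n)))
        (≤-trans enough (≤-reflexive (trans (cong (_+ 6) (total≡2length G degrees)) (lemma (length G))))))

  sufficient-tight : total d + 8 ≡ 4 * n → AtLeastAt d n 2 → Scheme d
  sufficient-tight #d last = by-size n≥4 d mono d≥2 #d
    where
    d≥2 : ∀ v → 2 ≤ d v
    d≥2 v = ≤-trans (last q 1+q≡n) (mono v q (s≤s⁻¹ (≤-trans (toℕ<n v) (≤-reflexive (sym 1+q≡n)))))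
      where
      n∸1<n : n ∸ 1 < n
      n∸1<n = ≤-reflexive (m+[n∸m]≡n (≤-trans (s≤s z≤n) (toℕ<n v)))
      q = fromℕ< n∸1<n
      1+q≡n : suc (toℕ q) ≡ n
      1+q≡n = trans (cong suc (toℕ-fromℕ< n∸1<n)) (m+[n∸m]≡n (≤-trans (s≤s z≤n) (toℕ<n v)))
    -- The total 4n - 8 is at least 2n.
    n≥4 : 4 ≤ n
    n≥4 = *-cancelˡ-≤ 2 (≤-by 0
      (+-mono-≤ (≤-trans (≤-reflexive (sym (total-const n 2))) (total-mono d≥2)) (≤-reflexive #d)) (lemma n (total d)))
      where
      lemma : ∀ n t → 2 * 4 + (t + 4 * n) + 0 ≡ 2 * n + (n * 2 + (t + 8))
      lemma = solve-∀
    by-size : ∀ {n} → 4 ≤ n → (d : Seq n) → NonIncreasing d → (∀ v → 2 ≤ d v) → total d + 8 ≡ 4 * n → Scheme d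
    by-size (s≤s (s≤s (s≤s (s≤s {n = k} _)))) = four-roots k

necessary-small : ∀ {n} (d : Seq n) → n ≤ 2 → Scheme d → 4 * n ≤ total d + 6
necessary-small d z≤n _ = z≤n
necessary-small d (s≤s z≤n) _ = ≤-trans (s≤s (s≤s (s≤s (s≤s z≤n)))) (m≤n+m 6 (total d))
necessary-small d (s≤s (s≤s z≤n)) ([] , _ , comp , _) with () ← comp F.zero (F.suc F.zero)
necessary-small d (s≤s (s≤s z≤n)) (cs@(_ ∷ _) , _ , _ , degrees) =
  +-monoˡ-≤ 6 (≤-trans (*-monoʳ-≤ 2 (s≤s z≤n)) (≤-reflexive (trans (sym (total-deg cs)) (total-cong degrees))))

-- For n = 2 the degree bound forces an edge, which joins the two vertices by looplessness.
complete-small : ∀ {n} (G : Multigraph n) → n ≤ 2 → All NoLoop G → 4 * n ≤ total (deg G) + 6 → Complete G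
complete-small G (s≤s z≤n) nl _ F.zero F.zero = ⇝-refl G
complete-small [] (s≤s (s≤s z≤n)) nl p with s≤s (s≤s (s≤s (s≤s (s≤s (s≤s ()))))) ← p
complete-small ((F.zero , F.zero) ∷ G) (s≤s (s≤s z≤n)) (a≢b ∷ _) _ = contradiction refl a≢b
complete-small ((F.suc F.zero , F.suc F.zero) ∷ G) (s≤s (s≤s z≤n)) (a≢b ∷ _) _ = contradiction refl a≢b
complete-small ((F.zero , F.suc F.zero) ∷ G) (s≤s (s≤s z≤n)) nl _ = λ where
  F.zero F.zero → skip (⇝-refl G)
  F.zero (F.suc F.zero) → fwd (⇝-refl G)
  (F.suc F.zero) F.zero → bwd (⇝-refl G)
  (F.suc F.zero) (F.suc F.zero) → skip (⇝-refl G)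
complete-small ((F.suc F.zero , F.zero) ∷ G) (s≤s (s≤s z≤n)) nl _ = λ where
  F.zero F.zero → skip (⇝-refl G)
  F.zero (F.suc F.zero) → bwd (⇝-refl G)
  (F.suc F.zero) F.zero → fwd (⇝-refl G)
  (F.suc F.zero) (F.suc F.zero) → skip (⇝-refl G)

theorem5p2 : (n : ℕ) (d : Seq n) → NonIncreasing d → Multigraphical d →
    TCRealizable d ⇔
    ((total d + 8 ≡ 4 * n × AtLeastAt d n 2)
    ⊎ (4 * n ≤ total d + 6 × (n ≤ 2 ⊎ (2 < n × AtLeastAt d (n ∸ 1) 2 × AtLeastAt d n 1))))
theorem5p2 n d mono graphical@(G , loopless , degrees) =
  mk⇔ (necessary ∘ TCRealizable⇒Scheme) (Scheme⇒TCRealizable ∘ sufficient)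
  where
  necessary : Scheme d → Conditions n d
  necessary s with n ≤? 2
  ... | yes n≤2 = inj₂ (necessary-small d n≤2 s , inj₁ n≤2)
  ... | no n≰2 = necessary-large mono (≰⇒> n≰2) s
  sufficient : Conditions n d → Scheme d
  sufficient (inj₁ (#d , last)) = sufficient-tight mono #d last
  sufficient (inj₂ (enough , inj₂ (n>2 , second , first))) = sufficient-large mono n>2 graphical enough second first
  -- For n at most 2 the given realization serves in the order in which its edges are listed.
  sufficient (inj₂ (enough , inj₁ n≤2)) =
    G , nl , complete-small G n≤2 nl (≤-trans enough (≤-reflexive (cong (_+ 6) (total-cong (sym ∘ degrees))))) , degrees
    where
    nl = Loopless⇒NoLoop G loopless
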